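{- Let $\mathbb{P}$ be the forcing poset consisting of triples $(T,F,A)$ satisfying: (1) $T=(|T|,<_T)$ is a finite tree on $\omega_1$; (2) $F$ is an injective function from the set of maximal nodes of $T$ into $\omega_2$; (3) $A$ is a finite adequate set; (4) if $M\in A$, $a$ and $b$ are distinct maximal nodes of $T$, and $F(a),F(b)\in M$, then every $c$ which is below both $a$ and $b$ in $T$ is in $M$; ordered by $(U,G,B)\le(T,F,A)$ iff $U$ end-extends $T$, $A\subseteq B$, and whenever $a$ is maximal in $T$ there is $b$ maximal in $U$ such that $a\le_U b$ and $F(a)=G(b)$. Then $\mathbb{P}$ is $\omega_2$-c.c.
   Context: Standing assumptions and notation. Assume $2^{\omega_1}=\omega_2$ and fix a bijection $\pi:\omega_2\to H(\omega_2)$. $P_{\omega_1}(\omega_2)$ is the set of countable subsets of $\omega_2$. Assume there is a stationary set $\mathcal{Y}\subseteq P_{\omega_1}(\omega_2)$ which is thin, i.e. for all $\beta<\omega_2$ the set $\{a\cap\beta: a\in\mathcal{Y}\}$ has size at most $\omega_1$; fix such a $\mathcal{Y}$ which is moreover closed under initial segments ($a\in\mathcal{Y}$, $\beta<\omega_2$ imply $a\cap\beta\in\mathcal{Y}$). Let $\mathcal{A}$ be the structure $(H(\omega_2),\in,\pi,\mathcal{Y})$, which has definable Skolem functions (via the well-ordering induced by $\pi$). For $a\subseteq H(\omega_2)$, $Sk(a)$ is the closure of $a$ under a fixed set of definable Skolem functions for $\mathcal{A}$. Let $C$ be the (club) set of $\beta<\omega_2$ with $Sk(\beta)\cap\omega_2=\beta$,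 and let $\Lambda$ be the set of $\beta<\omega_2$ of cofinality $\omega_1$ which are limit points of $C$. Let $\mathcal{X}$ be the set of $M\in\mathcal{Y}$ such that $Sk(M)\cap\omega_2=M$ and for all $\gamma\in M$, $\sup(C\cap\gamma)\in M$. Comparison points and adequacy. Fix a set $\Gamma\subseteq\Lambda$ which is stationary in $\omega_2$. For $M\in\mathcal{X}$, $\Gamma_M$ is the set of $\beta\in\Gamma$ such that $\beta=\min(\Gamma\setminus\sup(M\cap\beta))$, i.e. $\Gamma\cap[\sup(M\cap\beta),\beta)=\emptyset$. For $M,N\in\mathcal{X}$, $\Gamma_M\cap\Gamma_N$ has a largest element, denoted $\beta_{M,N}$. A set $A\subseteq\mathcal{X}$ is adequate if for all $M,N\in A$, either $M\cap\beta_{M,N}=N\cap\beta_{M,N}$, or $M\cap\beta_{M,N}\in Sk(N)$, or $N\cap\beta_{M,N}\in Sk(M)$. Finite trees. A finite tree on $\omega_1$ is a pair $T=(|T|,<_T)$ such that $|T|$ is a finite subset of $\omega_1$; $<_T$ is an irreflexive transitive relation on $|T|$; if $a,b<_T c$ then $a=b$, $a<_T b$ or $b<_T a$; and $a<_T b$ implies $a<b$. $U$ end-extends $T$ if $|T|\subseteq|U|$ and $<_U\cap(|T|\times|T|)=\ <_T$. A poset is $\omega_2$-c.c. if every antichain has size less than $\omega_2$. -}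

module Defs where

open import Level using (Level; 0ℓ; _⊔_) renaming (suc to lsuc)
open import Data.Bool using (Bool)
open import Data.Fin using (Fin)
open import Data.Nat using (ℕ; suc)
open import Data.Product using (Σ; ∃; _×_; _,_; proj₁; proj₂)
open import Data.Sum using (_⊎_; inj₁; inj₂; [_,_])
open import Data.Vec.Functional using (Vector; _∷_)
open import Function using (id)
open import Function.Bundles using (Func; Injection; Bijection; _⇔_; mk⇔; Equivalence)
open import Function.Relation.Binary.Setoid.Equality using (_⇨_)
open import Relation.Binary.Bundles using (Setoid)
open import Relation.Binary.Core using (Rel)
open import Relation.Binary.Definitions using (Transitive; _Respects₂_)
open import Relation.Binary.PropositionalEquality as ≡ using (_≡_)
open import Relation.Binary.Structures using (IsEquivalence)
import Relation.Binary.Construct.On as On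
open import Relation.Nullary using (¬_)
open import Relation.Unary using (Pred)

-- Aczel's iterative sets.  Given excluded middle at level one and function
-- extensionality, (V , ∈), with ≈ as equality, satisfies ZFC.  (The
-- library's ExcludedMiddle decides every type, not only propositions, so it
-- also selects elements of nonempty types; extensionality makes the
-- selection independent of the indexing of a set.)

data V : Set₁ where
  set : (A : Set) → (A → V) → V

Idx : V → Set
Idx (set A _) = A

elt : (x : V) → Idx x → V
elt (set _ f) = f

infix 4 _≈_ _≉_ _∈_ _⊆_

_≈_ : V → V → Set
set A f ≈ set B g = (∀ a → ∃ λ b → f a ≈ g b) × (∀ b → ∃ λ a → f a ≈ g b)

_≉_ : V → V → Set
x ≉ y = ¬ (x ≈ y)

≈-refl : ∀ {x} → x ≈ x
≈-refl {set A f} = (λ a → a , ≈-refl {f a}) , (λ a → a , ≈-refl {f a})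

≈-sym : ∀ {x y} → x ≈ y → y ≈ x
≈-sym {set A f} {set B g} (l , r) =
  (λ b → proj₁ (r b) , ≈-sym {f (proj₁ (r b))} (proj₂ (r b))) ,
  (λ a → proj₁ (l a) , ≈-sym {f a} (proj₂ (l a)))

≈-trans : ∀ {x y z} → x ≈ y → y ≈ z → x ≈ z
≈-trans {set A f} {set B g} {set C h} (l , r) (l′ , r′) =
  (λ a → let (b , p) = l a ; (c , q) = l′ b in c , ≈-trans {f a} {g b} {h c} p q) ,
  (λ c → let (b , q) = r′ c ; (a , p) = r b in a , ≈-trans {f a} {g b} {h c} p q)

-- The elements of x as a setoid.  Functions between sets are setoid
-- functions between these, and cardinalities are compared by injections.

⟦_⟧ : V → Setoid 0ℓ 0ℓ
⟦ x ⟧ = record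
  { Carrier = Idx x
  ; _≈_ = λ i j → elt x i ≈ elt x j
  ; isEquivalence = record
    { refl  = λ {i} → ≈-refl {elt x i}
    ; sym   = λ {i j} → ≈-sym {elt x i} {elt x j}
    ; trans = λ {i j k} → ≈-trans {elt x i} {elt x j} {elt x k}
    }
  }

-- Bounded quantifiers range over the index type, so that they do not raise
-- the universe level and can be used in separation.

∀∈ : ∀ {ℓ} (x : V) → (V → Set ℓ) → Set ℓ
∀∈ x P = (i : Idx x) → P (elt x i)

∃∈ : ∀ {ℓ} (x : V) → (V → Set ℓ) → Set ℓ
∃∈ x P = Σ (Idx x) λ i → P (elt x i)

infix 2 ∀∈ ∃∈
syntax ∀∈ x (λ y → P) = ∀[ y ∈ x ] P
syntax ∃∈ x (λ y → P) = ∃[ y ∈ x ] P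

_∈_ : V → V → Set
x ∈ y = Σ (Idx y) λ i → x ≈ elt y i

_⊆_ : V → V → Set
x ⊆ y = ∀[ z ∈ x ] (z ∈ y)

separate : (x : V) → (V → Set) → V
separate x P = set (Σ (Idx x) λ i → P (elt x i)) λ (i , _) → elt x i

syntax separate x (λ y → P) = ⟪ y ∈ x ∣ P ⟫

infixl 6 _∩_
_∩_ : V → V → V
x ∩ y = ⟪ z ∈ x ∣ z ∈ y ⟫

⋃ : V → V
⋃ x = set (Σ (Idx x) λ i → Idx (elt x i)) λ (i , j) → elt (elt x i) j

-- x ∪ ⋃ { trcl y : y ∈ x }
trcl : V → V
trcl (set A f) =
  set (A ⊎ Σ A λ a → Idx (trcl (f a))) [ f , (λ (a , i) → elt (trcl (f a)) i) ]

infix 4 _≼_ _≺_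

_≼_ : ∀ {a b c d} → Setoid a b → Setoid c d → Set (a ⊔ b ⊔ c ⊔ d)
S ≼ T = Injection S T

_≺_ : ∀ {a b c d} → Setoid a b → Setoid c d → Set (a ⊔ b ⊔ c ⊔ d)
S ≺ T = S ≼ T × ¬ (T ≼ S)

Finite : V → Set
Finite x = ∃ λ n → ⟦ x ⟧ ≼ ≡.setoid (Fin n)

Countable : V → Set
Countable x = ⟦ x ⟧ ≼ ≡.setoid ℕ

IsTransitive : V → Set
IsTransitive x = ∀[ y ∈ x ] (y ⊆ x)

-- Von Neumann ordinals: < is ∈, ≤ is ⊆, and the supremum of a set of
-- ordinals is its union (so sup ∅ = 0).
Ordinal : V → Set
Ordinal x = IsTransitive x × (∀[ y ∈ x ] IsTransitive y)

-- κ is |S|⁺, the least ordinal that does not inject into S.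
IsSuccessorCardinal : V → Setoid 0ℓ 0ℓ → Set
IsSuccessorCardinal κ S = Ordinal κ × ¬ (⟦ κ ⟧ ≼ S) × (∀[ α ∈ κ ] (⟦ α ⟧ ≼ S))

CofinalMap : V → V → Set
CofinalMap κ β =
  Σ (Func ⟦ κ ⟧ ⟦ β ⟧) λ f → ∀[ γ ∈ β ] Σ (Idx κ) λ ξ → γ ⊆ elt β (Func.to f ξ)

HasCofinality : V → V → Set
HasCofinality β κ = CofinalMap κ β × (∀[ δ ∈ κ ] (¬ CofinalMap δ β))

-- For ordinals β, the inhabitant of Idx β excludes β = 0.
IsLimitPoint : V → V → Set
IsLimitPoint D β = Idx β × (∀[ γ ∈ β ] ∃[ δ ∈ D ] (γ ∈ δ × δ ∈ β))

IsClub : V → V → Set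
IsClub κ D =
    D ⊆ κ
  × (∀[ α ∈ κ ] ∃[ δ ∈ D ] (α ∈ δ))
  × (∀[ β ∈ κ ] (IsLimitPoint D β → β ∈ D))

IsStationary : V → V → Set₁
IsStationary κ S = ∀ D → IsClub κ D → ∃[ α ∈ S ] (α ∈ D)

IsClubOfCountableSubsets : V → V → Set₁
IsClubOfCountableSubsets κ D =
    (∀[ a ∈ D ] (a ⊆ κ × Countable a))
  × (∀ a → a ⊆ κ → Countable a → ∃[ b ∈ D ] (a ⊆ b))
  × (∀ (a : ℕ → V) → (∀ n → a n ∈ D) → (∀ n → a n ⊆ a (suc n)) → ⋃ (set ℕ a) ∈ D)

IsStationaryInCountableSubsets : V → V → Set₁
IsStationaryInCountableSubsets κ 𝒴 =
    (∀[ a ∈ 𝒴 ] (a ⊆ κ × Countable a))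
  × (∀ D → IsClubOfCountableSubsets κ D → ∃[ a ∈ 𝒴 ] (a ∈ D))

-- ω₁, ω₂ and H(ω₂) are determined up to ≈ by their specifications.
record Setting : Set₁ where
  field
    ω₁ ω₂ : V
    ω₁-spec : IsSuccessorCardinal ω₁ (≡.setoid ℕ)
    ω₂-spec : IsSuccessorCardinal ω₂ ⟦ ω₁ ⟧

    2^ω₁≡ω₂ : Bijection (⟦ ω₁ ⟧ ⇨ ≡.setoid Bool) ⟦ ω₂ ⟧

    H⟨ω₂⟩ : V
    H⟨ω₂⟩-spec : ∀ x → x ∈ H⟨ω₂⟩ ⇔ ⟦ trcl x ⟧ ≺ ⟦ ω₂ ⟧

    π : Bijection ⟦ ω₂ ⟧ ⟦ H⟨ω₂⟩ ⟧

    𝒴 : V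
    𝒴-stationary : IsStationaryInCountableSubsets ω₂ 𝒴
    𝒴-thin : ∀[ β ∈ ω₂ ] (⟦ set (Idx 𝒴) (λ i → elt 𝒴 i ∩ β) ⟧ ≼ ⟦ ω₁ ⟧)
    𝒴-initial : ∀[ a ∈ 𝒴 ] ∀[ β ∈ ω₂ ] (a ∩ β ∈ 𝒴)

-- First-order formulas with n free variables (de Bruijn indices).  The
-- atom  π̇ i j  says that vᵢ < ω₂ and π(vᵢ) = vⱼ.
data Formula (n : ℕ) : Set where
  _≐_ _∈̇_ π̇ : Fin n → Fin n → Formula n
  𝒴̇ : Fin n → Formula n
  ¬̇_ : Formula n → Formula n
  _∧̇_ : Formula n → Formula n → Formula n
  ∃̇_ : Formula (suc n) → Formula n

module Hull (S : Setting) where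
  open Setting S

  H : V
  H = H⟨ω₂⟩

  Sat : ∀ {n} → Formula n → Vector (Idx H) n → Set
  Sat (i ≐ j) v = elt H (v i) ≈ elt H (v j)
  Sat (i ∈̇ j) v = elt H (v i) ∈ elt H (v j)
  Sat (π̇ i j) v = Σ (Idx ω₂) λ α →
    elt H (v i) ≈ elt ω₂ α × elt H (v j) ≈ elt H (Bijection.to π α)
  Sat (𝒴̇ i)   v = elt H (v i) ∈ 𝒴
  Sat (¬̇ φ)   v = ¬ Sat φ v
  Sat (φ ∧̇ ψ) v = Sat φ v × Sat ψ v
  Sat (∃̇ φ)   v = ∃ λ x → Sat φ (x ∷ v)

  _<π_ : Rel (Idx H) 0ℓ
  x <π y = ∃ λ α → ∃ λ β →
      elt H (Bijection.to π α) ≈ elt H x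
    × elt H (Bijection.to π β) ≈ elt H y
    × elt ω₂ α ∈ elt ω₂ β

  -- y is the value at v of the Skolem function of φ, which picks the
  -- π-least witness for the variable 0.  A Skolem function is left
  -- undefined where there is no witness; a default value such as ∅ would
  -- itself be definable and hence already in every hull.
  SkolemValue : ∀ {n} → Formula (suc n) → Vector (Idx H) n → Idx H → Set
  SkolemValue φ v y = Sat φ (y ∷ v) × (∀ z → Sat φ (z ∷ v) → ¬ (z <π y))

  data Closure (a : V) : Idx H → Set where
    base : ∀ {x} → elt H x ∈ a → Closure a x
    step : ∀ {n} (φ : Formula (suc n)) (v : Vector (Idx H) n) {y} →
           (∀ k → Closure a (v k)) → SkolemValue φ v y → Closure a y

  Sk : V → V
  Sk a = set (∃ λ x → Closure a x) λ (x , _) → elt H x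

  C : V
  C = ⟪ β ∈ ω₂ ∣ Sk β ∩ ω₂ ≈ β ⟫

  Λ : V
  Λ = ⟪ β ∈ ω₂ ∣ HasCofinality β ω₁ × IsLimitPoint C β ⟫

  𝒳 : V
  𝒳 = ⟪ M ∈ 𝒴 ∣ Sk M ∩ ω₂ ≈ M × (∀[ γ ∈ M ] (⋃ (C ∩ γ) ∈ M)) ⟫

module Adequacy (S : Setting) (Γ : V) where
  open Setting S
  open Hull S

  -- Γ_M: those β ∈ Γ with Γ ∩ [sup(M ∩ β), β) = ∅.
  Γ⟨_⟩ : V → V
  Γ⟨ M ⟩ = ⟪ β ∈ Γ ∣ ∀[ γ ∈ Γ ] (¬ (⋃ (M ∩ β) ⊆ γ × γ ∈ β)) ⟫

  IsLargest : V → V → Set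
  IsLargest β x = β ∈ x × (∀[ δ ∈ x ] (δ ⊆ β))

  -- The comparison point is a β given by this relation, not by a function;
  -- a largest element is unique up to ≈.
  IsComparisonPoint : V → V → V → Set
  IsComparisonPoint M N β = IsLargest β (Γ⟨ M ⟩ ∩ Γ⟨ N ⟩)

  Adequate : V → Set
  Adequate A =
      A ⊆ 𝒳
    × (∀[ M ∈ A ] ∀[ N ∈ A ] ∃[ β ∈ ω₂ ]
        ( IsComparisonPoint M N β
        × (M ∩ β ≈ N ∩ β ⊎ M ∩ β ∈ Sk N ⊎ N ∩ β ∈ Sk M)))

record FiniteTree (ω₁ : V) : Set₁ where
  infix 4 _<_ _≤_
  field
    nodes : V
    nodes⊆ω₁ : nodes ⊆ ω₁
    finite : Finite nodes
    _<_ : Rel V 0ℓ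
    <-resp-≈ : _<_ Respects₂ _≈_
    <⇒nodes : ∀ {a b} → a < b → a ∈ nodes × b ∈ nodes
    <-irrefl : ∀ {a} → ¬ (a < a)
    <-trans : Transitive _<_
    <-below : ∀ {a b c} → a < c → b < c → a ≈ b ⊎ a < b ⊎ b < a
    <⇒∈ : ∀ {a b} → a < b → a ∈ b

  _≤_ : Rel V 0ℓ
  a ≤ b = a < b ⊎ a ≈ b

  Max : V
  Max = ⟪ a ∈ nodes ∣ ∀[ b ∈ nodes ] (¬ (a < b)) ⟫

_EndExtends_ : ∀ {ω₁} → FiniteTree ω₁ → FiniteTree ω₁ → Set
U EndExtends T =
    T.nodes ⊆ U.nodes
  × (∀[ a ∈ T.nodes ] ∀[ b ∈ T.nodes ] (a U.< b ⇔ a T.< b))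
  where
  module T = FiniteTree T
  module U = FiniteTree U

module _ {c ℓ r} (P : Setoid c ℓ) (_≤_ : Rel (Setoid.Carrier P) r) where
  open Setoid P using () renaming (Carrier to ∣P∣; _≈_ to _≈P_)

  Compatible : Rel ∣P∣ (c ⊔ r)
  Compatible p q = ∃ λ s → s ≤ p × s ≤ q

  IsAntichain : ∀ {a} → Pred ∣P∣ a → Set (c ⊔ ℓ ⊔ r ⊔ a)
  IsAntichain A = ∀ {p q} → A p → A q → ¬ (p ≈P q) → ¬ Compatible p q

  ChainCondition : V → (a : Level) → Set (c ⊔ ℓ ⊔ r ⊔ lsuc a)
  ChainCondition κ a =
    (A : Pred ∣P∣ a) → IsAntichain A → On.setoid {B = Σ ∣P∣ A} P proj₁ ≺ ⟦ κ ⟧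

module Forcing (S : Setting) (Γ : V) where
  open Setting S
  open Hull S
  open Adequacy S Γ

  record Condition : Set₁ where
    field
      T : FiniteTree ω₁
    open FiniteTree T public
    field
      F : Injection ⟦ Max ⟧ ⟦ ω₂ ⟧

    max : Idx Max → V
    max i = elt Max i

    label : Idx Max → V
    label i = elt ω₂ (Injection.to F i)

    field
      A : V
      A-finite : Finite A
      A-adequate : Adequate A
      separated : ∀[ M ∈ A ] (∀ a b → max a ≉ max b → label a ∈ M → label b ∈ M →
                  ∀ c → c < max a → c < max b → c ∈ M)

    Graph : V → V → Set
    Graph a α = ∃ λ i → a ≈ max i × α ≈ label i

  open Condition

  infix 4 _≤ℙ_

  _≤ℙ_ : Rel Condition 0ℓ
  q ≤ℙ p =
      T q EndExtends T p
    × A p ⊆ A q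
    × (∀ a → ∃ λ b → FiniteTree._≤_ (T q) (max p a) (max q b) × label p a ≈ label q b)

  _≈ℙ_ : Rel Condition (lsuc 0ℓ)
  p ≈ℙ q =
      nodes p ≈ nodes q
    × (∀ a b → FiniteTree._<_ (T p) a b ⇔ FiniteTree._<_ (T q) a b)
    × (∀ a α → Graph p a α ⇔ Graph q a α)
    × A p ≈ A q

  private
    ⇔-refl : ∀ {P : Set} → P ⇔ P
    ⇔-refl = mk⇔ id id

    ⇔-sym : ∀ {P Q : Set} → P ⇔ Q → Q ⇔ P
    ⇔-sym e = mk⇔ (Equivalence.from e) (Equivalence.to e)

    ⇔-trans : ∀ {P Q R : Set} → P ⇔ Q → Q ⇔ R → P ⇔ R
    ⇔-trans e f = mk⇔ (λ p → Equivalence.to f (Equivalence.to e p))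
                      (λ r → Equivalence.from e (Equivalence.from f r))

  ≈ℙ-isEquivalence : IsEquivalence _≈ℙ_
  ≈ℙ-isEquivalence = record
    { refl = λ {p} →
        ≈-refl {nodes p} , (λ _ _ → ⇔-refl) , (λ _ _ → ⇔-refl) , ≈-refl {A p}
    ; sym = λ {p q} (n , l , g , e) →
        ≈-sym {nodes p} {nodes q} n , (λ a b → ⇔-sym (l a b)) ,
        (λ a α → ⇔-sym (g a α)) , ≈-sym {A p} {A q} e
    ; trans = λ {p q r} (n , l , g , e) (n′ , l′ , g′ , e′) →
        ≈-trans {nodes p} {nodes q} {nodes r} n n′ ,
        (λ a b → ⇔-trans (l a b) (l′ a b)) ,
        (λ a α → ⇔-trans (g a α) (g′ a α)) ,
        ≈-trans {A p} {A q} {A r} e e′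
    }

  ℙ : Setoid (lsuc 0ℓ) (lsuc 0ℓ)
  ℙ = record { isEquivalence = ≈ℙ-isEquivalence }

-- Given ω₂ inequivalent conditions p(α), let γ(β) < β, for β ∈ Γ, bound
-- below β all ordinals below β that occur in p(β), as a label or in a model;
-- γ(β) exists since cof(β) = ω₁.  The type of p(β) consists of γ(β), the
-- tree, the labels below γ(β) and the traces on γ(β) of the models.  As 𝒴 is
-- thin, there are only ω₁ types for a given γ.  So a club of δ reflects all
-- types with γ < δ: if some p(α) has the type, one with α and all its
-- ordinals below δ does.  For β ∈ Γ in this club, this gives α < β in Γ such
-- that p(α) has the type of p(β) and all its ordinals lie below β.
--
-- These two conditions are compatible.  For each label of either one, add a
-- new node above the maximal node that bears it; the only common labels lie
-- below γ and are at the same node, and the labels that lie in a model of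
-- one condition are labels of that condition.  The union of the two sets of models is
-- adequate: for M from p(α) and N from p(β), take a model M′ of p(α) with
-- M′ ∩ γ = N ∩ γ.  Then ζ = β_{M,N} exists and is at most α and at most
-- β_{M,M′}, and the relation between M and M′ restricts to ζ.  If M ∩ ζ lies
-- in Sk(M′), it lies in Sk(N) because its π-index is in M′ and below α, which
-- holds when α is in a club obtained from thinness.

module Submission where

open import Defs
open import Level using (Level; 0ℓ; Lift; lift; lower) renaming (suc to lsuc)
open import Axiom.ExcludedMiddle using (ExcludedMiddle)
open import Axiom.Extensionality.Propositional using (Extensionality; lower-extensionality)
open import Data.Bool using (Bool; true; false; if_then_else_)
open import Data.Empty using (⊥)
open import Data.Fin using (Fin; zero; suc; join; splitAt)
open import Data.Fin.Patterns using (0F; 1F; 2F; 3F; 4F; 5F)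
open import Data.Fin.Properties using (toℕ-injective; splitAt-join)
open import Data.List using (List; []; _∷_; map; concatMap; filter; allFin; cartesianProduct)
open import Data.List.Membership.Propositional using () renaming (_∈_ to _∈ₗ_)
open import Data.List.Membership.Propositional.Properties
  using (∈-map⁺; ∈-concatMap⁺; ∈-filter⁺; ∈-filter⁻; ∈-allFin; ∈-cartesianProduct⁺)
open import Data.List.Relation.Unary.Any as Any using (here)
open import Data.Maybe using (Maybe; just; nothing; maybe)
open import Data.Nat as ℕ using (ℕ; zero; suc; _+_; s≤s; z≤n)
open import Data.Nat.Induction using (<-wellFounded)
import Data.Nat.Properties as ℕ
open import Data.Product using (Σ; ∃; _×_; _,_; proj₁; proj₂)
open import Data.Sum using (_⊎_; inj₁; inj₂; [_,_])
open import Data.Sum.Properties using (inj₁-injective; inj₂-injective)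
open import Data.Vec.Functional using (Vector) renaming ([] to []ᵥ; _∷_ to _∷ᵥ_)
open import Function using (id; _∘_)
open import Function.Bundles using (Func; Injection; Bijection; Equivalence; _↣_; mk↣; mk⇔)
open import Function.Construct.Composition using (_↣-∘_)
open import Induction.WellFounded using (WellFounded; Acc; acc; module All; module FixPoint)
open import Relation.Binary.Bundles using (Setoid)
import Relation.Binary.Construct.On as On
open import Relation.Binary.Core using (Rel)
open import Relation.Binary.Definitions using (tri<; tri≈; tri>)
open import Relation.Binary.PropositionalEquality using (_≡_; refl; sym; trans; cong; cong₂; subst; setoid)
open import Relation.Binary.PropositionalEquality.WithK using (≡-irrelevant)
open import Relation.Nullary using (Dec; yes; no; ¬_; does; contradiction)
open import Relation.Nullary.Decidable using (map′; decidable-stable; dec-true)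

-- As x ≈ y and x ∈ y unfold, x and y cannot be inferred from them; they can
-- from the record versions.

-- New nodes are unavoidable: one maximal node of the common tree may bear one label in p(α) and a
-- different one in p(β), while F is a function. With one new node for each label there is room for
-- both. Clause (4) survives because two distinct labels in a model of one condition belong to that
-- condition, where they sit at distinct maximal nodes. A comparison point must be exhibited for
-- every new pair of models, so its existence is proved together with the relation between the two
-- models. Restricting that relation from β_{M,M′} to ζ rests on a fact about hulls: a countable
-- element of a hull is a subset of it. Proving this inside the given first-order language is the
-- longest detour; it replaces the usual enumeration by ω with a graph on the countable set itself.
-- Cardinal arithmetic starts from the bare specifications of ω₁ and ω₂. Regularity of ω₂ comes from
-- an injection of ω₁ × ω₁ into ω₁. Antichains are predicates on a large type with its own equality,
-- so the comparison of cardinals is carried out for setoids at an arbitrary level.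

infix 4 _≅_ _ε_ _⊑_

record _≅_ (x y : V) : Set where
  constructor eq
  field un : x ≈ y

open _≅_

record _ε_ (x y : V) : Set where
  constructor mem
  field
    idx : Idx y
    is  : x ≅ elt y idx

open _ε_

_⊑_ : V → V → Set₁
x ⊑ y = ∀ {z} → z ε x → z ε y

ε→∈ : ∀ {x y} → x ε y → x ∈ y
ε→∈ (mem i (eq p)) = i , p

∈→ε : ∀ {x y} → x ∈ y → x ε y
∈→ε (i , p) = mem i (eq p)

≅-refl : ∀ {x} → x ≅ x
≅-refl {x} = eq (≈-refl {x})

≅-sym : ∀ {x y} → x ≅ y → y ≅ x
≅-sym {x} {y} (eq p) = eq (≈-sym {x} {y} p)

≅-trans : ∀ {x y z} → x ≅ y → y ≅ z → x ≅ z
≅-trans {x} {y} {z} (eq p) (eq q) = eq (≈-trans {x} {y} {z} p q)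

≅-reflexive : ∀ {x y} → x ≡ y → x ≅ y
≅-reflexive refl = ≅-refl

elt-ε : ∀ {x} (i : Idx x) → elt x i ε x
elt-ε i = mem i ≅-refl

ε-respˡ : ∀ {x x′ y} → x ≅ x′ → x ε y → x′ ε y
ε-respˡ e (mem i p) = mem i (≅-trans (≅-sym e) p)

≅→⊑ : ∀ {x y} → x ≅ y → x ⊑ y
≅→⊑ {set A f} {set B g} (eq (l , _)) (mem a p) = let (b , q) = l a in mem b (≅-trans p (eq q))

⊑-antisym : ∀ {x y} → x ⊑ y → y ⊑ x → x ≅ y
⊑-antisym {set A f} {set B g} s t = eq
  ( (λ a → ε→∈ (s (elt-ε {set A f} a)))
  , (λ b → let mem a (eq p) = t (elt-ε {set B g} b) in a , ≈-sym {g b} {f a} p))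

⊆→⊑ : ∀ {x y} → x ⊆ y → x ⊑ y
⊆→⊑ s (mem i p) = ε-respˡ (≅-sym p) (∈→ε (s i))

⊑→⊆ : ∀ {x y} → x ⊑ y → x ⊆ y
⊑→⊆ s i = ε→∈ (s (elt-ε i))

ε-wellFounded : WellFounded _ε_
ε-wellFounded x = below x ≅-refl
  where
  below : ∀ x {y} → y ≅ x → Acc _ε_ y
  below (set A f) e = acc λ p → let mem a q = ≅→⊑ e p in below (f a) q

ε-irrefl : ∀ {x y} → x ≅ y → ¬ (x ε y)
ε-irrefl {x} e p = go (ε-wellFounded x) (≅→⊑ (≅-sym e) p)
  where
  go : ∀ {x} → Acc _ε_ x → ¬ (x ε x)
  go (acc rs) p = go (rs p) p

∩⁺ : ∀ {x y z} → z ε x → z ε y → z ε x ∩ y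
∩⁺ (mem i p) q = mem (i , ε→∈ (ε-respˡ p q)) p

∩⁻ : ∀ x y {z} → z ε x ∩ y → z ε x × z ε y
∩⁻ x y (mem (i , q) p) = mem i p , ε-respˡ (≅-sym p) (∈→ε {y = y} q)

∩-congˡ : ∀ {x x′} y → x ≅ x′ → x ∩ y ≅ x′ ∩ y
∩-congˡ {x} {x′} y e = ⊑-antisym
  (λ p → let (q , r) = ∩⁻ x y p in ∩⁺ (≅→⊑ e q) r)
  (λ p → let (q , r) = ∩⁻ x′ y p in ∩⁺ (≅→⊑ (≅-sym e) q) r)

∩-congʳ : ∀ x {y y′} → y ≅ y′ → x ∩ y ≅ x ∩ y′
∩-congʳ x {y} {y′} e = ⊑-antisym
  (λ p → let (q , r) = ∩⁻ x y p in ∩⁺ q (≅→⊑ e r))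
  (λ p → let (q , r) = ∩⁻ x y′ p in ∩⁺ q (≅→⊑ (≅-sym e) r))

trcl-⊒ : ∀ {x} → x ⊑ trcl x
trcl-⊒ {set A f} (mem a p) = mem (inj₁ a) p

trcl-elt : ∀ {x} i → trcl (elt x i) ⊑ trcl x
trcl-elt {set A f} a (mem i p) = mem (inj₂ (a , i)) p

trcl⁻ : ∀ x {z} → z ε trcl x → z ε x ⊎ ∃ λ i → z ε trcl (elt x i)
trcl⁻ (set A f) (mem (inj₁ a) p)       = inj₁ (mem a p)
trcl⁻ (set A f) (mem (inj₂ (a , i)) p) = inj₂ (a , mem i p)

trcl-mono : ∀ x {y} → x ⊑ y → trcl x ⊑ trcl y
trcl-mono (set A f) s (mem (inj₁ a) p) = trcl-⊒ (s (mem a p))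
trcl-mono (set A f) s (mem (inj₂ (a , i)) p) =
  let mem j q = s (elt-ε {set A f} a) in trcl-elt j (trcl-mono (f a) (≅→⊑ q) (mem i p))

trcl-ε : ∀ {x y} → y ε x → trcl y ⊑ trcl x
trcl-ε {y = y} (mem i p) q = trcl-elt i (trcl-mono y (≅→⊑ p) q)

-- Ordinals, and a pairing of natural numbers

record Ord (x : V) : Set₁ where
  field
    transitive : ∀ {y z} → z ε y → y ε x → z ε x
    hereditary : ∀ {y z w} → w ε z → z ε y → y ε x → w ε y

Ordinal→Ord : ∀ {x} → Ordinal x → Ord x
Ordinal→Ord {x} (t , h) = record
  { transitive = λ p (mem i q) → ⊆→⊑ (t i) (≅→⊑ q p)
  ; hereditary = λ r q (mem i p) →
      let mem j q′ = ≅→⊑ p q in ≅→⊑ (≅-sym p) (⊆→⊑ (h i j) (≅→⊑ q′ r))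
  }

Ord-ε : ∀ {x y} → Ord x → y ε x → Ord y
Ord-ε o p = record
  { transitive = λ r q → hereditary r q p
  ; hereditary = λ t r q → hereditary t r (transitive q p)
  }
  where open Ord o

double : ℕ → ℕ
double zero    = zero
double (suc n) = suc (suc (double n))

double-injective : ∀ {m n} → double m ≡ double n → m ≡ n
double-injective {zero}  {zero}  _ = refl
double-injective {suc m} {suc n} e = cong suc (double-injective (ℕ.suc-injective (ℕ.suc-injective e)))

odd≢double : ∀ m n → ¬ (suc (double m) ≡ double n)
odd≢double (suc m) (suc n) e = odd≢double m n (ℕ.suc-injective (ℕ.suc-injective e))

-- The code of (m , n) is 2^m (2n + 1).
ℕ×ℕ↣ℕ : (ℕ × ℕ) ↣ ℕ
ℕ×ℕ↣ℕ = mk↣ {to = code} λ {x} {y} → injective x y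
  where
  code : ℕ × ℕ → ℕ
  code (zero  , n) = suc (double n)
  code (suc m , n) = double (code (m , n))

  injective : ∀ x y → code x ≡ code y → x ≡ y
  injective (zero  , n) (zero  , q) e = cong (zero ,_) (double-injective (ℕ.suc-injective e))
  injective (zero  , n) (suc p , q) e = contradiction e (odd≢double n _)
  injective (suc m , n) (zero  , q) e = contradiction (sym e) (odd≢double q _)
  injective (suc m , n) (suc p , q) e with injective (m , n) (p , q) (double-injective e)
  ... | refl = refl

-- Choice, canonical elements of sets, and recursion

module Classical (em : ExcludedMiddle (lsuc 0ℓ)) (ext : Extensionality (lsuc 0ℓ) (lsuc 0ℓ)) where

  opaque
    decide : (P : Set) → Dec P
    decide P = map′ lower lift em

    by-contradiction : {P : Set} → ¬ ¬ P → P
    by-contradiction = decidable-stable (decide _)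

  module _ {Y : Set} where

    pick : (Y → Bool) → Y → Y
    pick P y₀ with decide (∃ λ y → P y ≡ true)
    ... | yes (y , _) = y
    ... | no _        = y₀

    pick-correct : ∀ (P : Y → Bool) y₀ → P y₀ ≡ true → P (pick P y₀) ≡ true
    pick-correct P y₀ t with decide (∃ λ y → P y ≡ true)
    ... | yes (_ , p) = p
    ... | no _        = t

    -- `decide` is applied to a statement about the predicate alone, so the witness that it returns
    -- depends on neither default.
    pick-unique : ∀ {P Q : Y → Bool} {y₀ y₁} → P ≡ Q → P y₀ ≡ true → pick P y₀ ≡ pick Q y₁
    pick-unique {P} {_} {y₀} refl t with decide (∃ λ y → P y ≡ true)
    ... | yes _ = refl
    ... | no ∄  = contradiction (y₀ , t) ∄

  opaque
    -- Equivalent x determine the same Boolean predicate R x on Y, by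
    -- extensionality, and the choice depends on that predicate only.
    respecting-choice : ∀ {a b r} {X : Set a} (_~_ : Rel X b) {Y : Set} (R : X → Y → Set r) →
      (∀ x y → Dec (R x y)) →
      (∀ {x x′ y} → x ~ x′ → R x y → R x′ y) → (∀ {x x′ y} → x ~ x′ → R x′ y → R x y) →
      (∀ x → ∃ (R x)) →
      Σ (X → Y) λ f → (∀ x → R x (f x)) × (∀ {x x′} → x ~ x′ → f x ≡ f x′)
    respecting-choice {X = X} _~_ {Y} R R? R⁺ R⁻ total = f , correct , respects
      where
      χ : X → Y → Bool
      χ x y = does (R? x y)

      χ-total : ∀ x → χ x (proj₁ (total x)) ≡ true
      χ-total x = dec-true (R? x _) (proj₂ (total x))

      f : X → Y
      f x = pick (χ x) (proj₁ (total x))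

      correct : ∀ x → R x (f x)
      correct x with R? x (f x) | pick-correct (χ x) (proj₁ (total x)) (χ-total x)
      ... | yes r | _  = r
      ... | no _  | ()

      same : ∀ {x x′} → x ~ x′ → ∀ y → χ x y ≡ χ x′ y
      same {x} {x′} e y with R? x y | R? x′ y
      ... | yes _ | yes _ = refl
      ... | no _  | no _  = refl
      ... | yes r | no ¬r = contradiction (R⁺ e r) ¬r
      ... | no ¬r | yes r = contradiction (R⁻ e r) ¬r

      respects : ∀ {x x′} → x ~ x′ → f x ≡ f x′
      respects {x} e =
        pick-unique (lower-extensionality _ _ ext (same e)) (χ-total x)

  private
    -- The choice is constant on indices of equal elements and stays among them, hence is
    -- idempotent. Its fixed points provide one index per element.
    normal : ∀ x → Σ (Idx x → Idx x) λ f →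
      (∀ i → elt x i ≅ elt x (f i)) × (∀ {i j} → elt x i ≅ elt x j → f i ≡ f j)
    normal x = respecting-choice (λ i j → elt x i ≅ elt x j) (λ i j → elt x i ≅ elt x j)
      (λ _ _ → decide _) (λ e p → ≅-trans (≅-sym e) p) ≅-trans (λ i → i , ≅-refl)

  -- The elements of x up to ≈, with ≡ as their equality.
  record El (x : V) : Set where
    constructor el
    field
      index : Idx x
      is-normal : proj₁ (normal x) index ≡ index

  open El

  index-injective : ∀ {x} {a b : El x} → index a ≡ index b → a ≡ b
  index-injective {a = el i p} {b = el .i q} refl = cong (el i) (≡-irrelevant p q)

  opaque
    val : ∀ {x} → El x → V
    val {x} a = elt x (index a)

    val-index : ∀ {x} (a : El x) → val a ≅ elt x (index a)
    val-index a = ≅-refl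

    val-ε : ∀ {x} (a : El x) → val a ε x
    val-ε a = elt-ε (index a)

    val-injective : ∀ {x} {a b : El x} → val a ≅ val b → a ≡ b
    val-injective {x} {el i p} {el j q} e =
      index-injective (trans (sym p) (trans (proj₂ (proj₂ (normal x)) e) q))

    toEl : ∀ {x y} → y ε x → El x
    toEl {x} (mem i p) = let (f , correct , respects) = normal x in
      el (f i) (respects (≅-sym (correct i)))

    val-toEl : ∀ {x y} (p : y ε x) → val (toEl p) ≅ y
    val-toEl {x} (mem i p) = ≅-sym (≅-trans p (proj₁ (proj₂ (normal x)) i))

  toEl-cong : ∀ {x y z} {p : y ε x} {q : z ε x} → y ≅ z → toEl p ≡ toEl q
  toEl-cong {p = p} {q} e = val-injective (≅-trans (val-toEl p) (≅-trans e (≅-sym (val-toEl q))))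

  toEl-injective : ∀ {x y z} {p : y ε x} {q : z ε x} → toEl p ≡ toEl q → y ≅ z
  toEl-injective {p = p} {q} e =
    ≅-trans (≅-sym (val-toEl p)) (≅-trans (≅-reflexive (cong val e)) (val-toEl q))

  elt-index : ∀ {x} (a b : El x) → elt x (index a) ≈ elt x (index b) → a ≡ b
  elt-index a b e = val-injective (≅-trans (val-index a) (≅-trans (eq e) (≅-sym (val-index b))))

  ↣-from : ∀ {x} {A : Set} → ⟦ x ⟧ ≼ setoid A → El x ↣ A
  ↣-from f = mk↣ λ {a} {b} e → elt-index a b (injective e)
    where open Injection f

  ↣-to : ∀ {x} {A : Set} → El x ↣ A → ⟦ x ⟧ ≼ setoid A
  ↣-to f = record
    { to        = λ i → to (toEl (elt-ε i))
    ; cong      = λ e → cong to (toEl-cong (eq e))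
    ; injective = λ e → un (toEl-injective (injective e))
    }
    where open Injection f using (to; injective)

  ↣-fromEl : ∀ {x y} → ⟦ x ⟧ ≼ ⟦ y ⟧ → El x ↣ El y
  ↣-fromEl {x} {y} f = mk↣ {to = λ a → toEl (elt-ε {y} (to (index a)))}
    λ {a} {b} e → elt-index a b (injective (un (toEl-injective e)))
    where open Injection f

  ↣-toEl : ∀ {x y} → El x ↣ El y → ⟦ x ⟧ ≼ ⟦ y ⟧
  ↣-toEl {x} {y} f = record
    { to        = λ i → index (to (toEl (elt-ε i)))
    ; cong      = λ e → un (≅-reflexive (cong (λ a → elt y (index (to a))) (toEl-cong (eq e))))
    ; injective = λ e → un (toEl-injective (injective (elt-index _ _ e)))
    }
    where open Injection f using (to; injective)

  inclusion : ∀ {x y} → x ⊑ y → El x ↣ El y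
  inclusion s = mk↣ {to = λ a → toEl (s (val-ε a))} λ e → val-injective (toEl-injective e)

  El-wellFounded : ∀ {x} → WellFounded (λ (a b : El x) → val a ε val b)
  El-wellFounded a = On.accessible val (ε-wellFounded (val a))

  minimal : ∀ {A : Set} {_⊲_ : Rel A 0ℓ} → WellFounded _⊲_ →
    (P : A → Set) → ∃ P → ∃ λ a → P a × (∀ b → b ⊲ a → ¬ P b)
  minimal {_⊲_ = _⊲_} wf P (a , p) = go (wf a) p
    where
    go : ∀ {a} → Acc _⊲_ a → P a → ∃ λ a → P a × (∀ b → b ⊲ a → ¬ P b)
    go {a} (acc rs) p with decide (∃ λ b → b ⊲ a × P b)
    ... | yes (b , l , q) = go (rs l) q
    ... | no ∄            = a , p , λ b l q → ∄ (b , l , q)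

  opaque
    trichotomy : ∀ {a b} → Ord a → Ord b → a ε b ⊎ a ≅ b ⊎ b ε a
    trichotomy {a} {b} = go (ε-wellFounded a) (ε-wellFounded b)
      where
      go : ∀ {a b} → Acc _ε_ a → Acc _ε_ b → Ord a → Ord b → a ε b ⊎ a ≅ b ⊎ b ε a
      go {a} {b} (acc rs) (acc ts) o u with decide (a ε b) | decide (b ε a)
      ... | yes p | _     = inj₁ p
      ... | no _  | yes q = inj₂ (inj₂ q)
      ... | no a∉b | no b∉a = inj₂ (inj₁ (⊑-antisym l r))
        where
        l : a ⊑ b
        l p with go (rs p) (acc ts) (Ord-ε o p) u
        ... | inj₁ q        = q
        ... | inj₂ (inj₁ e) = contradiction (ε-respˡ e p) b∉a
        ... | inj₂ (inj₂ q) = contradiction (Ord.transitive o q p) b∉a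
        r : b ⊑ a
        r p with go (acc rs) (ts p) o (Ord-ε u p)
        ... | inj₁ q        = contradiction (Ord.transitive u q p) a∉b
        ... | inj₂ (inj₁ e) = contradiction (ε-respˡ (≅-sym e) p) a∉b
        ... | inj₂ (inj₂ q) = q

    ∌→⊑ : ∀ {a b} → Ord a → Ord b → ¬ (b ε a) → a ⊑ b
    ∌→⊑ o u b∉a p with trichotomy o u
    ... | inj₁ q        = Ord.transitive u p q
    ... | inj₂ (inj₁ e) = ≅→⊑ e p
    ... | inj₂ (inj₂ q) = contradiction q b∉a

  ⊑→∌ : ∀ {a b} → a ⊑ b → ¬ (b ε a)
  ⊑→∌ s p = ε-irrefl ≅-refl (s p)

  module _ {W : Set} {_⊲_ : Rel W 0ℓ} (wf : WellFounded _⊲_)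
           {x r : Level} {X : Set x} (Good : Rel X r) (ext′ : Extensionality 0ℓ x) (x₀ : X)
           (fresh : ∀ w (g : W → X) → ∃ λ x → ∀ v → v ⊲ w → Good (g v) x) where

    private
      extend : ∀ w → (∀ {v} → v ⊲ w → X) → W → X
      extend w g v with decide (v ⊲ w)
      ... | yes l = g l
      ... | no _  = x₀

      extend-cong : ∀ w {g h : ∀ {v} → v ⊲ w → X} → (∀ {v} (l : v ⊲ w) → g l ≡ h l) →
                    ∀ v → extend w g v ≡ extend w h v
      extend-cong w e v with decide (v ⊲ w)
      ... | yes l = e l
      ... | no _  = refl

      extend-total : ∀ {w v} (f : W → X) → v ⊲ w → extend w (λ {u} _ → f u) v ≡ f v
      extend-total {w} {v} f l with decide (v ⊲ w)
      ... | yes _ = refl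
      ... | no ¬l = contradiction l ¬l

      next : ∀ w → (∀ {v} → v ⊲ w → X) → X
      next w g = proj₁ (fresh w (extend w g))

      next-cong : ∀ w {g h : ∀ {v} → v ⊲ w → X} → (∀ {v} (l : v ⊲ w) → g l ≡ h l) →
                  next w g ≡ next w h
      next-cong w e = cong (λ f → proj₁ (fresh w f)) (ext′ (extend-cong w e))

      f : W → X
      f = All.wfRec wf x (λ _ → X) next

      unfold : ∀ w → f w ≡ next w (λ {v} _ → f v)
      unfold w = FixPoint.unfold-wfRec wf (λ _ → X) next (λ w {g} {h} → next-cong w {g} {h})

    opaque
      -- Well-founded recursion on w. As `fresh` takes a function on all of W, the earlier values
      -- are padded with `x₀`. Extensionality serves to unfold the recursion, since pointwise equal
      -- functions must lead to the same choice.
      greedy : Σ (W → X) λ f → ∀ {v w} → v ⊲ w → Good (f v) (f w)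
      greedy = f , λ {v} {w} l → subst (Good (f v)) (sym (unfold w))
        (subst (λ y → Good y (next w (λ {u} _ → f u))) (extend-total f l)
          (proj₂ (fresh w (extend w (λ {u} _ → f u))) v l))

  -- Comparability of cardinals, and regularity of successor cardinals

  module Ordinals {κ : V} (κ-ord : Ord κ) where

    val-ord : (ξ : El κ) → Ord (val ξ)
    val-ord ξ = Ord-ε κ-ord (val-ε ξ)

    below : (ξ : El κ) → El (val ξ) → El κ
    below ξ η = toEl (Ord.transitive κ-ord (val-ε η) (val-ε ξ))

    val-below : (ξ : El κ) (η : El (val ξ)) → val (below ξ η) ≅ val η
    val-below ξ η = val-toEl _

    compare : (ξ η : El κ) → val ξ ε val η ⊎ ξ ≡ η ⊎ val η ε val ξ
    compare ξ η with trichotomy (val-ord ξ) (val-ord η)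
    ... | inj₁ p        = inj₁ p
    ... | inj₂ (inj₁ e) = inj₂ (inj₁ (val-injective e))
    ... | inj₂ (inj₂ p) = inj₂ (inj₂ p)

    -- Comparability of cardinals: choose pairwise inequivalent elements of S
    -- along κ, unless the choices exhaust S at some stage.
    embed : ∀ {ℓ} → ExcludedMiddle ℓ → Extensionality 0ℓ ℓ → (S : Setoid ℓ ℓ) {A : Set} →
      (∀ (α : El κ) → El (val α) ↣ A) → ¬ (S ≼ setoid A) →
      Σ (El κ → Setoid.Carrier S) λ f → ∀ {ξ η} → Setoid._≈_ S (f ξ) (f η) → ξ ≡ η
    embed em′ ext′ S {A} small S⋠A = f , injective
      where
      module S = Setoid S

      -- Sending x to an earlier stage at which it was chosen injects S into α, and α injects into
      -- A.
      exhausted : ∀ α (g : El κ → S.Carrier) →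
        ¬ (∃ λ x → ∀ β → val β ε val α → ¬ (g β S.≈ x)) → S ≼ setoid A
      exhausted α g ∄ =
        let (h , correct , respects) = respecting-choice S._≈_ (λ x β → g (below α β) S.≈ x)
              (λ _ _ → em′) (λ e p → S.trans p e) (λ e p → S.trans p (S.sym e)) hit
        in record
          { to        = λ x → to (h x)
          ; cong      = λ e → cong to (respects e)
          ; injective = λ {x} {y} e → S.trans (S.sym (correct x))
              (subst (λ b → g (below α b) S.≈ y) (sym (injective e)) (correct y))
          }
        where
        open Injection (small α) using (to; injective)
        hit : ∀ x → ∃ λ β → g (below α β) S.≈ x
        hit x = decidable-stable em′ λ ∄β → ∄ (x , λ β l e →
          ∄β (toEl l , subst (λ b → g b S.≈ x) (val-injective
            (≅-sym (≅-trans (val-below α _) (val-toEl l)))) e))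

      fresh : ∀ α (g : El κ → S.Carrier) → ∃ λ x → ∀ β → val β ε val α → ¬ (g β S.≈ x)
      fresh α g = decidable-stable em′ λ ∄ → S⋠A (exhausted α g ∄)

      x₀ : S.Carrier
      x₀ = decidable-stable em′ λ ∄ → S⋠A record
        { to = λ x → contradiction x ∄ ; cong = λ {x} _ → contradiction x ∄ ; injective = λ {x} _ → contradiction x ∄ }

      chosen : Σ (El κ → S.Carrier) λ f → ∀ {ξ η} → val ξ ε val η → ¬ (f ξ S.≈ f η)
      chosen = greedy El-wellFounded (λ x y → ¬ (x S.≈ y)) ext′ x₀ fresh

      f : El κ → S.Carrier
      f = proj₁ chosen

      injective : ∀ {ξ η} → f ξ S.≈ f η → ξ ≡ η
      injective {ξ} {η} e with compare ξ η
      ... | inj₁ p        = contradiction e (proj₂ chosen p)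
      ... | inj₂ (inj₁ p) = p
      ... | inj₂ (inj₂ p) = contradiction (S.sym e) (proj₂ chosen p)

  module SuccessorCardinal {κ : V} (κ-ord : Ord κ) {W : Set} (κ⋠W : ¬ (El κ ↣ W))
    (small : ∀ (α : El κ) → El (val α) ↣ W) (W×W↣W : (W × W) ↣ W) {w₀ w₁ : W} (w₀≢w₁ : ¬ (w₀ ≡ w₁)) where

    open Ordinals κ-ord public

    enumerate : ∀ (α : El κ) → El (val α) ↣ W
    enumerate = small

    private
      open Injection W×W↣W using () renaming (to to pair; injective to pair-injective)
      module small α = Injection (small α)

    opaque
      -- Regularity of κ. Otherwise each ξ fails for some i and so lies below the ordinal given for
      -- i; the pair of i and the place of ξ in the enumeration of that ordinal would inject κ into
      -- W × W.
      bounded : {I : Set} → I ↣ W → (R : I → El κ → Set) →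
        (∀ {i ξ η} → val ξ ⊑ val η → R i ξ → R i η) →
        (∀ i → ∃ (R i)) → ∃ λ ξ → ∀ i → R i ξ
      bounded {I} e R mono total =
        by-contradiction λ ∄ → κ⋠W (mk↣ {to = code ∄} λ {ξ} {η} → injective ∄ ξ η)
        where
        module _ (∄ : ¬ (∃ λ ξ → ∀ i → R i ξ)) where

          escape : ∀ ξ → ∃ λ i → ¬ R i ξ
          escape ξ = by-contradiction λ ∄i → ∄ (ξ , λ i → by-contradiction λ ¬r → ∄i (i , ¬r))

          ξ<h : ∀ ξ → val ξ ε val (proj₁ (total (proj₁ (escape ξ))))
          ξ<h ξ = by-contradiction λ ∉ →
            proj₂ (escape ξ) (mono (∌→⊑ (val-ord _) (val-ord ξ) ∉) (proj₂ (total _)))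

          code : El κ → W
          code ξ = pair (Injection.to e (proj₁ (escape ξ)) , small.to _ (toEl (ξ<h ξ)))

          same : ∀ {i j x y} (p : x ε val (proj₁ (total i))) (q : y ε val (proj₁ (total j))) → i ≡ j →
                 small.to (proj₁ (total i)) (toEl p) ≡ small.to (proj₁ (total j)) (toEl q) → x ≅ y
          same p q refl c = toEl-injective (small.injective _ c)

          injective : ∀ ξ η → code ξ ≡ code η → ξ ≡ η
          injective ξ η c = let c′ = pair-injective c in
            val-injective (same (ξ<h ξ) (ξ<h η) (Injection.injective e (cong proj₁ c′)) (cong proj₂ c′))

    private
      module _ (ξ : El κ) (∄ : ¬ (∃ λ (η : El κ) → val ξ ε val η)) where

        -- If ξ were the largest element, κ would be ξ + 1 and would inject into W, with the tag
        -- `w₀` for the elements below ξ and `w₁` for ξ itself.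
        top-code : El κ → W
        top-code η with compare η ξ
        ... | inj₁ p        = pair (w₀ , small.to ξ (toEl p))
        ... | inj₂ (inj₁ _) = pair (w₁ , w₁)
        ... | inj₂ (inj₂ p) = contradiction (η , p) ∄

        top-code-injective : ∀ a b → top-code a ≡ top-code b → a ≡ b
        top-code-injective a b e with compare a ξ | compare b ξ
        ... | inj₁ p | inj₁ q = val-injective (toEl-injective (small.injective ξ (cong proj₂ (pair-injective e))))
        ... | inj₁ _ | inj₂ (inj₁ _) = contradiction (cong proj₁ (pair-injective e)) w₀≢w₁
        ... | inj₂ (inj₁ _) | inj₁ _ = contradiction (sym (cong proj₁ (pair-injective e))) w₀≢w₁
        ... | inj₂ (inj₁ p) | inj₂ (inj₁ q) = trans p (sym q)
        ... | inj₂ (inj₂ p) | _ = contradiction (a , p) ∄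
        ... | _ | inj₂ (inj₂ p) = contradiction (b , p) ∄

    opaque
      no-maximum : ∀ (ξ : El κ) → ∃ λ (η : El κ) → val ξ ε val η
      no-maximum ξ = by-contradiction λ ∄ →
        κ⋠W (mk↣ {to = top-code ξ ∄} λ {a} {b} → top-code-injective ξ ∄ a b)

    next : El κ → El κ
    next ξ = proj₁ (no-maximum ξ)

    <-next : ∀ ξ → val ξ ε val (next ξ)
    <-next ξ = proj₂ (no-maximum ξ)

    nextⁿ : ℕ → El κ → El κ
    nextⁿ zero    ξ = ξ
    nextⁿ (suc n) ξ = next (nextⁿ n ξ)

    nextⁿ-⊒ : ∀ n ξ → val ξ ⊑ val (nextⁿ n ξ)
    nextⁿ-⊒ zero    ξ p = p
    nextⁿ-⊒ (suc n) ξ p = Ord.transitive (val-ord _) (nextⁿ-⊒ n ξ p) (<-next _)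

    nextⁿ-mono : ∀ {m n} ξ → m ℕ.< n → val (nextⁿ m ξ) ε val (nextⁿ n ξ)
    nextⁿ-mono {m} {suc n} ξ (s≤s m≤n) with ℕ.m≤n⇒m<n∨m≡n m≤n
    ... | inj₁ m<n  = Ord.transitive (val-ord _) (nextⁿ-mono ξ m<n) (<-next _)
    ... | inj₂ refl = <-next _

    nextⁿ-injective : ∀ {m n} ξ → nextⁿ m ξ ≡ nextⁿ n ξ → m ≡ n
    nextⁿ-injective {m} {n} ξ e with ℕ.<-cmp m n
    ... | tri< m<n _ _ = contradiction (nextⁿ-mono ξ m<n) (ε-irrefl (≅-reflexive (cong val e)))
    ... | tri≈ _ m≡n _ = m≡n
    ... | tri> _ _ n<m = contradiction (nextⁿ-mono ξ n<m) (ε-irrefl (≅-reflexive (cong val (sym e))))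

    opaque
      element : El κ
      element = by-contradiction λ ∄ → κ⋠W (mk↣ {to = λ x → contradiction x ∄} λ {x} → contradiction x ∄)

    opaque
      ∃-upper : ∀ (ξ η : El κ) → ∃ λ (ζ : El κ) → val ξ ε val ζ × val η ε val ζ
      ∃-upper ξ η with compare ξ η
      ... | inj₁ p           = next η , Ord.transitive (val-ord _) p (<-next η) , <-next η
      ... | inj₂ (inj₁ refl) = next η , <-next η , <-next η
      ... | inj₂ (inj₂ p)    = next ξ , <-next ξ , Ord.transitive (val-ord _) p (<-next ξ)

  -- Arithmetic of ω₁ and ω₂

  module Cardinals (S : Setting) where
    open Setting S

    private
      em₀ : ExcludedMiddle 0ℓ
      em₀ {P} = decide P

      ext₀ : Extensionality 0ℓ 0ℓ
      ext₀ = lower-extensionality _ _ ext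

    ω₁-ord : Ord ω₁
    ω₁-ord = Ordinal→Ord (proj₁ ω₁-spec)

    ω₂-ord : Ord ω₂
    ω₂-ord = Ordinal→Ord (proj₁ ω₂-spec)

    module ω₁ = SuccessorCardinal ω₁-ord {ℕ}
      (λ f → proj₁ (proj₂ ω₁-spec) (↣-to f))
      (λ α → ↣-from (proj₂ (proj₂ ω₁-spec) (index α)) ↣-∘ inclusion (≅→⊑ (val-index α)))
      ℕ×ℕ↣ℕ {0} {1} (λ ())

    opaque
      ℕ↣ω₁ : ℕ ↣ El ω₁
      ℕ↣ω₁ = mk↣ {to = λ n → ω₁.nextⁿ n ω₁.element} (ω₁.nextⁿ-injective ω₁.element)

    private
      0≢1 : ¬ (Injection.to ℕ↣ω₁ 0 ≡ Injection.to ℕ↣ω₁ 1)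
      0≢1 e = contradiction (Injection.injective ℕ↣ω₁ {0} {1} e) λ ()

    private
      module small α = Injection (ω₁.enumerate α)

      opaque
        -- The role of α ↦ ω · α: the finite successors of `f α` form a row that ends before `f β`
        -- begins. Such an `f β` exists because the rows before it have only countably many
        -- elements.
        spread : Σ (El ω₁ → El ω₁) λ f →
          ∀ {α β : El ω₁} → val α ε val β → ∀ n → val (ω₁.nextⁿ n (f α)) ε val (f β)
        spread = greedy El-wellFounded (λ (ξ η : El ω₁) → ∀ n → val (ω₁.nextⁿ n ξ) ε val η) ext₀ ω₁.element fresh
          where
          fresh : ∀ (β : El ω₁) (g : El ω₁ → El ω₁) →
            ∃ λ (η : El ω₁) → ∀ (α : El ω₁) → val α ε val β → ∀ n → val (ω₁.nextⁿ n (g α)) ε val η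
          fresh β g =
            let (η , above) = ω₁.bounded {I = El (val β) × ℕ}
                  (ℕ×ℕ↣ℕ ↣-∘ mk↣ {to = λ (α , n) → small.to β α , n}
                    λ e → cong₂ _,_ (small.injective β (cong proj₁ e)) (cong proj₂ e))
                  (λ (α , n) (η : El ω₁) → val (ω₁.nextⁿ n (g (ω₁.below β α))) ε val η)
                  (λ s p → s p) (λ (α , n) → ω₁.no-maximum _)
            in η , λ α l n → subst (λ α → val (ω₁.nextⁿ n (g α)) ε val η)
                  (val-injective (≅-trans (ω₁.val-below β _) (val-toEl l))) (above (toEl l , n))

      row : El ω₁ → El ω₁
      row = proj₁ spread

      row-disjoint : ∀ {α β : El ω₁} m n → val α ε val β → ¬ (ω₁.nextⁿ m (row α) ≡ ω₁.nextⁿ n (row β))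
      row-disjoint m n l e = ε-irrefl (≅-reflexive (cong val e))
        (ω₁.nextⁿ-⊒ n _ (proj₂ spread l m))

      ω₁×ℕ↣ω₁ : (El ω₁ × ℕ) ↣ El ω₁
      ω₁×ℕ↣ω₁ = mk↣ {to = λ (α , n) → ω₁.nextⁿ n (row α)} λ {x} {y} → injective x y
        where
        injective : ∀ x y → ω₁.nextⁿ (proj₂ x) (row (proj₁ x)) ≡ ω₁.nextⁿ (proj₂ y) (row (proj₁ y)) → x ≡ y
        injective (α , m) (β , n) e with ω₁.compare α β
        ... | inj₁ l           = contradiction e (row-disjoint m n l)
        ... | inj₂ (inj₁ refl) = cong (α ,_) (ω₁.nextⁿ-injective (row α) e)
        ... | inj₂ (inj₂ l)    = contradiction (sym e) (row-disjoint n m l)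

      -- Below a common strict bound μ, both ordinals are given by natural numbers in the
      -- enumeration of μ, so μ and one natural number determine the pair.
      code : El ω₁ × El ω₁ → El ω₁
      code (α , β) = let (μ , p , q) = ω₁.∃-upper α β in
        Injection.to ω₁×ℕ↣ω₁ (μ , Injection.to ℕ×ℕ↣ℕ (small.to μ (toEl p) , small.to μ (toEl q)))

      code-injective : ∀ x y → code x ≡ code y → x ≡ y
      code-injective (α , β) (γ , δ) e =
        let (_ , p , q)   = ω₁.∃-upper α β
            (_ , p′ , q′) = ω₁.∃-upper γ δ
            e′ = Injection.injective ω₁×ℕ↣ω₁ e
            (α≅γ , β≅δ) = same p p′ q q′ (cong proj₁ e′) (Injection.injective ℕ×ℕ↣ℕ (cong proj₂ e′))
        in cong₂ _,_ (val-injective α≅γ) (val-injective β≅δ)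
        where
        same : ∀ {μ ν} {a b c d : V} (p : a ε val μ) (p′ : c ε val ν) (q : b ε val μ) (q′ : d ε val ν) → μ ≡ ν →
          (small.to μ (toEl p) , small.to μ (toEl q)) ≡ (small.to ν (toEl p′) , small.to ν (toEl q′)) →
          a ≅ c × b ≅ d
        same p p′ q q′ refl e =
          toEl-injective (small.injective _ (cong proj₁ e)) ,
          toEl-injective (small.injective _ (cong proj₂ e))

    opaque
      ω₁×ω₁↣ω₁ : (El ω₁ × El ω₁) ↣ El ω₁
      ω₁×ω₁↣ω₁ = mk↣ {to = code} λ {x} {y} → code-injective x y

    opaque
      ω₁⊎ω₁↣ω₁ : (El ω₁ ⊎ El ω₁) ↣ El ω₁
      ω₁⊎ω₁↣ω₁ = mk↣ {to = to} λ {x} {y} → injective x y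
        where
        open Injection ω₁×ω₁↣ω₁ using () renaming (to to pair; injective to pair-injective)
        to : El ω₁ ⊎ El ω₁ → El ω₁
        to (inj₁ a) = pair (Injection.to ℕ↣ω₁ 0 , a)
        to (inj₂ a) = pair (Injection.to ℕ↣ω₁ 1 , a)

        injective : ∀ x y → to x ≡ to y → x ≡ y
        injective (inj₁ a) (inj₁ b) e = cong inj₁ (cong proj₂ (pair-injective e))
        injective (inj₁ a) (inj₂ b) e = contradiction (cong proj₁ (pair-injective e)) 0≢1
        injective (inj₂ a) (inj₁ b) e = contradiction (sym (cong proj₁ (pair-injective e))) 0≢1
        injective (inj₂ a) (inj₂ b) e = cong inj₂ (cong proj₂ (pair-injective e))

    module ω₂ = SuccessorCardinal ω₂-ord {El ω₁}
      (λ f → proj₁ (proj₂ ω₂-spec) (↣-toEl f))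
      (λ α → ↣-fromEl (proj₂ (proj₂ ω₂-spec) (index α)) ↣-∘ inclusion (≅→⊑ (val-index α)))
      ω₁×ω₁↣ω₁ 0≢1

    opaque
      ω₂⋠ω₁ : ¬ (El ω₂ ↣ El ω₁)
      ω₂⋠ω₁ f = proj₁ (proj₂ ω₂-spec) (↣-toEl f)

    opaque
      ω₁↣ω₂ : El ω₁ ↣ El ω₂
      ω₁↣ω₂ =
        let (f , injective) = ω₁.embed em₀ ext₀ ⟦ ω₂ ⟧ {ℕ} ω₁.enumerate
              (λ g → ω₂⋠ω₁ (ℕ↣ω₁ ↣-∘ ↣-from g))
        in mk↣ {to = λ ξ → toEl (elt-ε (f ξ))} λ e → injective (un (toEl-injective e))

    ω₂-embed : ∀ {ℓ} → ExcludedMiddle ℓ → Extensionality 0ℓ ℓ → (X : Setoid ℓ ℓ) → ¬ (X ≼ setoid (El ω₁)) →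
      Σ (El ω₂ → Setoid.Carrier X) λ f → ∀ {ξ η} → Setoid._≈_ X (f ξ) (f η) → ξ ≡ η
    ω₂-embed em′ ext′ X = ω₂.embed em′ ext′ X ω₂.enumerate

    ≺ω₂-intro : ∀ {a ℓ} {X : Setoid a ℓ} → X ≼ setoid (El ω₁) → X ≺ ⟦ ω₂ ⟧
    ≺ω₂-intro {X = X} f = ≼ω₂ , λ g → ω₂⋠ω₁ (mk↣ {to = λ ξ → f.to (Injection.to g (index ξ))}
      λ {a} {b} e → elt-index a b (Injection.injective g (f.injective e)))
      where
      module f = Injection f
      ≼ω₂ : X ≼ ⟦ ω₂ ⟧
      ≼ω₂ = record
        { to        = λ x → index (Injection.to ω₁↣ω₂ (f.to x))
        ; cong      = λ e → un (≅-reflexive (cong (λ w → elt ω₂ (index (Injection.to ω₁↣ω₂ w))) (f.cong e)))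
        ; injective = λ e → f.injective (Injection.injective ω₁↣ω₂ (elt-index _ _ e))
        }

    ≺ω₂-elim : ∀ {x} → ⟦ x ⟧ ≺ ⟦ ω₂ ⟧ → El x ↣ El ω₁
    ≺ω₂-elim {x} (_ , ω₂⋠x) with em {Lift _ (⟦ x ⟧ ≼ setoid (El ω₁))}
    ... | yes (lift f) = ↣-from f
    ... | no ∄ =
      let (f , injective) = ω₂-embed em₀ ext₀ ⟦ x ⟧ (λ g → ∄ (lift g))
          f′ : El ω₂ ↣ El x
          f′ = mk↣ {to = λ ξ → toEl (elt-ε {x} (f ξ))} λ e → injective (un (toEl-injective e))
      in contradiction (↣-toEl f′) ω₂⋠x

-- H(ω₂) and Skolem hulls

infix 6 ⟅_,_⟆

⟅_,_⟆ : V → V → V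
⟅ a , b ⟆ = set Bool λ t → if t then a else b

⟅⟆⁻ : ∀ {a b z} → z ε ⟅ a , b ⟆ → z ≅ a ⊎ z ≅ b
⟅⟆⁻ (mem true p)  = inj₁ p
⟅⟆⁻ (mem false p) = inj₂ p

module Hulls (em : ExcludedMiddle (lsuc 0ℓ)) (ext : Extensionality (lsuc 0ℓ) (lsuc 0ℓ)) (S : Setting) where
  open Classical em ext
  open El
  open Setting S
  open Cardinals S
  open Hull S

  opaque
    H-intro : ∀ {x} → El (trcl x) ↣ El ω₁ → x ε H
    H-intro {x} f = ∈→ε {x} {H} (Equivalence.from (H⟨ω₂⟩-spec x) (≺ω₂-intro (↣-to f)))

    H-elim : ∀ {x} → x ε H → El (trcl x) ↣ El ω₁
    H-elim {x} p = ≺ω₂-elim (Equivalence.to (H⟨ω₂⟩-spec x) (ε→∈ p))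

  H-transitive : ∀ {x y} → y ε x → x ε H → y ε H
  H-transitive p q = H-intro (H-elim q ↣-∘ inclusion (trcl-ε p))

  H-⊑ : ∀ {x y} → y ⊑ x → x ε H → y ε H
  H-⊑ {y = y} s q = H-intro (H-elim q ↣-∘ inclusion (trcl-mono y s))

  opaque
    -- The transitive closure of y consists of y and the transitive closures of its elements: at
    -- most ω₁ sets, each of size at most ω₁.
    H-collect : ∀ {y} → y ⊑ H → El y ↣ El ω₁ → y ε H
    H-collect {y} s e = H-intro (mk↣ {to = λ z → code z (where-is z)}
      λ {z} {z′} → injective z z′ (where-is z) (where-is z′))
      where
      h : (u : El y) → El (trcl (val u)) ↣ El ω₁
      h u = H-elim (s (val-ε u))

      Where : El (trcl y) → Set
      Where z = val z ε y ⊎ Σ (El y) λ u → val z ε trcl (val u)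

      where-is : ∀ z → Where z
      where-is z with trcl⁻ y (val-ε z)
      ... | inj₁ p       = inj₁ p
      ... | inj₂ (i , p) = inj₂ (toEl (elt-ε i) , trcl-mono (elt y i) (≅→⊑ (≅-sym (val-toEl _))) p)

      code : ∀ z → Where z → El ω₁
      code z (inj₁ p)       = Injection.to ω₁⊎ω₁↣ω₁ (inj₁ (Injection.to e (toEl p)))
      code z (inj₂ (u , p)) = Injection.to ω₁⊎ω₁↣ω₁ (inj₂
        (Injection.to ω₁×ω₁↣ω₁ (Injection.to e u , Injection.to (h u) (toEl p))))

      same : ∀ {u v} {a b : V} (p : a ε trcl (val u)) (q : b ε trcl (val v)) → u ≡ v →
             Injection.to (h u) (toEl p) ≡ Injection.to (h v) (toEl q) → a ≅ b
      same p q refl c = toEl-injective (Injection.injective (h _) c)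

      injective : ∀ z z′ w w′ → code z w ≡ code z′ w′ → z ≡ z′
      injective z z′ (inj₁ p) (inj₁ q) c =
        val-injective (toEl-injective (Injection.injective e (inj₁-injective (Injection.injective ω₁⊎ω₁↣ω₁ c))))
      injective z z′ (inj₁ p) (inj₂ _) c with Injection.injective ω₁⊎ω₁↣ω₁ c
      ... | ()
      injective z z′ (inj₂ _) (inj₁ q) c with Injection.injective ω₁⊎ω₁↣ω₁ c
      ... | ()
      injective z z′ (inj₂ (u , p)) (inj₂ (v , q)) c =
        let c′ = Injection.injective ω₁×ω₁↣ω₁ (inj₂-injective (Injection.injective ω₁⊎ω₁↣ω₁ c)) in
        val-injective (same p q (Injection.injective e (cong proj₁ c′)) (cong proj₂ c′))

    ω₂⊑H : ω₂ ⊑ H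
    ω₂⊑H p = go (ε-wellFounded _) p
      where
      go : ∀ {x} → Acc _ε_ x → x ε ω₂ → x ε H
      go (acc rs) p = H-collect
        (λ q → go (rs q) (Ord.transitive ω₂-ord q p))
        (ω₂.enumerate (toEl p) ↣-∘ inclusion (≅→⊑ (≅-sym (val-toEl p))))

  π⟨_⟩ : El ω₂ → V
  π⟨ ξ ⟩ = elt H (Bijection.to π (index ξ))

  π-toEl : ∀ i → π⟨ toEl (elt-ε {ω₂} i) ⟩ ≅ elt H (Bijection.to π i)
  π-toEl i = eq (Bijection.cong π (un (≅-trans (≅-sym (val-index _)) (val-toEl (elt-ε {ω₂} i)))))

  π-injective : ∀ {ξ η} → π⟨ ξ ⟩ ≅ π⟨ η ⟩ → ξ ≡ η
  π-injective {ξ} {η} (eq e) = elt-index ξ η (Bijection.injective π e)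

  π-surjective : ∀ {x} → x ε H → ∃ λ ξ → π⟨ ξ ⟩ ≅ x
  π-surjective (mem i p) =
    let (α , e) = Bijection.strictlySurjective π i
    in toEl (elt-ε α) , ≅-trans (π-toEl α) (≅-trans (eq e) (≅-sym p))

  opaque
    -- The Tarski-Vaught test for hulls. The minimum is taken over π-indices, which are
    -- well-founded, and only then turned into a witness.
    skolem : ∀ {K n} (φ : Formula (suc n)) (v : Vector (Idx H) n) → (∀ k → Closure K (v k)) →
      (∃ λ y → Sat φ (y ∷ᵥ v)) → ∃ λ y → Closure K y × Sat φ (y ∷ᵥ v)
    skolem {K} φ v c (y , sat) =
      let (ξ , (y , sat , e) , least) = minimal El-wellFounded
            (λ ξ → ∃ λ y → Sat φ (y ∷ᵥ v) × π⟨ ξ ⟩ ≅ elt H y)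
            (let (ξ , e) = π-surjective (elt-ε y) in ξ , y , sat , e)
      in y , step φ v c (sat , λ { z sat′ (α , β , p , q , α∈β) →
           let α′ = toEl (elt-ε {ω₂} α)
               β≡ξ : toEl (elt-ε {ω₂} β) ≡ ξ
               β≡ξ = π-injective (≅-trans (π-toEl β) (≅-trans (eq q) (≅-sym e)))
               α<ξ : val α′ ε val ξ
               α<ξ = ε-respˡ (≅-sym (val-toEl _))
                 (≅→⊑ (≅-trans (≅-sym (val-toEl _)) (≅-reflexive (cong val β≡ξ))) (∈→ε α∈β))
           in least α′ α<ξ (z , sat′ , ≅-trans (π-toEl α) (eq p)) }) , sat

  -- `Closure` is a predicate on indices. The Skolem function of the formula `v₀ = v₁` reaches every
  -- index of the same set, because its witnesses all have the same π-index and none precedes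
  -- another.
  Closure-resp : ∀ {K i j} → elt H i ≅ elt H j → Closure K i → Closure K j
  Closure-resp {i = i} {j} e c = step (zero ≐ suc zero) (i ∷ᵥ []ᵥ) (λ { zero → c })
    (un (≅-sym e) , λ { z z≈i (α , β , p , q , α∈β) →
      let β≡α = π-injective (≅-trans (π-toEl β) (≅-trans (eq q) (≅-trans (≅-sym e)
                  (≅-trans (≅-sym (eq z≈i)) (≅-trans (≅-sym (eq p)) (≅-sym (π-toEl α)))))))
      in ε-irrefl (≅-sym (toEl-injective β≡α)) (∈→ε α∈β) })

  Closure-mono : ∀ {K L i} → K ⊑ L → Closure K i → Closure L i
  Closure-mono s (base p)       = base (ε→∈ (s (∈→ε p)))
  Closure-mono s (step φ v c y) = step φ v (λ k → Closure-mono s (c k)) y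

  Sk-mono : ∀ {K L} → K ⊑ L → Sk K ⊑ Sk L
  Sk-mono s (mem (i , c) p) = mem (i , Closure-mono s c) p

  Sk⊑H : ∀ {K} → Sk K ⊑ H
  Sk⊑H (mem (i , _) p) = mem i p

  Sk→Closure : ∀ {K i} → elt H i ε Sk K → Closure K i
  Sk→Closure (mem (j , c) p) = Closure-resp (≅-sym p) c

  Closure→Sk : ∀ {K i} → Closure K i → elt H i ε Sk K
  Closure→Sk {i = i} c = mem (i , c) ≅-refl

  opaque
    Sk-∩ : ∀ {K x r} → x ε Sk K → r ε Sk K → x ∩ r ε Sk K
    Sk-∩ {K} {x} {r} (mem (i , c) p) (mem (j , d) q) =
      let (y , c′ , l , g) = skolem φ (i ∷ᵥ j ∷ᵥ []ᵥ) (λ { zero → c ; (suc zero) → d })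
            (idx x∩r , (λ { (z , z∈ , z∉) → let (z∈x , z∈r) = ∩⁻ x r (≅→⊑ (≅-sym (is x∩r)) (∈→ε z∈))
                              in z∉ (ε→∈ (≅→⊑ p z∈x) , ε→∈ (≅→⊑ q z∈r)) })
                     , (λ { (z , (z∈x , z∈r) , z∉) →
                          z∉ (ε→∈ (≅→⊑ (is x∩r) (∩⁺ (≅→⊑ (≅-sym p) (∈→ε z∈x)) (≅→⊑ (≅-sym q) (∈→ε z∈r))))) }))
          y≅ : elt H y ≅ x ∩ r
          y≅ = ⊑-antisym
            (λ {z} z∈ → let mem k e = H-transitive z∈ (elt-ε y)
                            (z∈x , z∈r) = by-contradiction λ ∉ → l (k , ε→∈ (ε-respˡ e z∈) , ∉)
                        in ∩⁺ (ε-respˡ (≅-sym e) (≅→⊑ (≅-sym p) (∈→ε z∈x)))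
                              (ε-respˡ (≅-sym e) (≅→⊑ (≅-sym q) (∈→ε z∈r))))
            (λ {z} z∈ → let (z∈x , z∈r) = ∩⁻ x r z∈
                            mem k e = H-transitive z∈ (mem (idx x∩r) (is x∩r))
                        in ε-respˡ (≅-sym e) (∈→ε (by-contradiction λ ∉ →
                             g (k , (ε→∈ (ε-respˡ e (≅→⊑ p z∈x)) , ε→∈ (ε-respˡ e (≅→⊑ q z∈r))) , ∉))))
      in ε-respˡ y≅ (Closure→Sk c′)
      where
      -- The two inclusions between `v₀` and `v₁ ∩ v₂`, each as the absence of a counterexample.
      -- Counterexamples in H suffice because H is transitive.
      φ : Formula 3
      φ = (¬̇ (∃̇ ((zero ∈̇ suc zero) ∧̇
             (¬̇ ((zero ∈̇ suc (suc zero)) ∧̇ (zero ∈̇ suc (suc (suc zero))))))))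
        ∧̇ (¬̇ (∃̇ (((zero ∈̇ suc (suc zero)) ∧̇ (zero ∈̇ suc (suc (suc zero))))
             ∧̇ (¬̇ (zero ∈̇ suc zero)))))

      x∩r : x ∩ r ε H
      x∩r = H-⊑ (λ z∈ → proj₁ (∩⁻ x r z∈)) (mem i p)

  -- For countable x with an injection e into ℕ, put x before all elements of
  -- x, and let E consist of the pairs of consecutive members of x ∪ {x} in
  -- the order given by e.  The set E is characterised well enough by the
  -- first-order property that a subset of x ∪ {x} containing x is everything,
  -- unless two of its members u, u′ determine a new member, as the neighbour
  -- of u in the graph E other than u′.
  private
    module Path {x : V} (e : El x ↣ ℕ) where
      open Injection e using () renaming (injective to #-injective)

      # : El x → ℕ
      # = Injection.to e

      Node : Set
      Node = Maybe (El x)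

      node : Node → V
      node = maybe val x

      nodes : V
      nodes = set Node node

      rank : Node → ℕ
      rank = maybe (λ a → suc (# a)) zero

      node-injective : ∀ {u v} → node u ≅ node v → u ≡ v
      node-injective {just _}  {just _}  p = cong just (val-injective p)
      node-injective {just a}  {nothing} p = contradiction (val-ε a) (ε-irrefl p)
      node-injective {nothing} {just a}  p = contradiction (val-ε a) (ε-irrefl (≅-sym p))
      node-injective {nothing} {nothing} p = refl

      rank-injective : ∀ {u v} → rank u ≡ rank v → u ≡ v
      rank-injective {just _}  {just _}  p = cong just (#-injective (ℕ.suc-injective p))
      rank-injective {nothing} {nothing} p = refl

      IsPredecessor : El x → Node → Set
      IsPredecessor a u = rank u ℕ.< suc (# a) × (∀ v → rank v ℕ.< suc (# a) → rank v ℕ.≤ rank u)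

      opaque
        maximum-below : ∀ n → (∃ λ u → rank u ℕ.< n) → ∃ λ u → rank u ℕ.< n × (∀ v → rank v ℕ.< n → rank v ℕ.≤ rank u)
        maximum-below (suc n) (u , l) with decide (∃ λ v → rank v ≡ n)
        ... | yes (v , refl) = v , ℕ.n<1+n _ , λ { w (s≤s l) → l }
        ... | no ∄ =
          let (v , l , max) = maximum-below n (u , below u l)
          in v , ℕ.m<n⇒m<1+n l , λ w l → max w (below w l)
          where
          below : ∀ w → rank w ℕ.< suc n → rank w ℕ.< n
          below w (s≤s l) with ℕ.m≤n⇒m<n∨m≡n l
          ... | inj₁ l = l
          ... | inj₂ p = contradiction (w , p) ∄

        predecessor : ∀ a → ∃ (IsPredecessor a)
        predecessor a = maximum-below (suc (# a)) (nothing , s≤s z≤n)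

      pred : El x → Node
      pred a = proj₁ (predecessor a)

      pred-< : ∀ a → rank (pred a) ℕ.< suc (# a)
      pred-< a = proj₁ (proj₂ (predecessor a))

      -- If `a` came before `b`, it would lie strictly between the common predecessor and `b`.
      pred-injective : ∀ {a b} → pred a ≡ pred b → a ≡ b
      pred-injective {a} {b} p with ℕ.<-cmp (# a) (# b)
      ... | tri< l _ _ = contradiction (pred-< a) (λ l′ → ℕ.<-irrefl refl (ℕ.<-≤-trans l′
            (subst (λ u → suc (# a) ℕ.≤ rank u) (sym p) (proj₂ (proj₂ (predecessor b)) (just a) (s≤s l)))))
      ... | tri≈ _ q _ = #-injective q
      ... | tri> _ _ l = contradiction (pred-< b) (λ l′ → ℕ.<-irrefl refl (ℕ.<-≤-trans l′
            (subst (λ u → suc (# b) ℕ.≤ rank u) p (proj₂ (proj₂ (predecessor a)) (just b) (s≤s l)))))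

      edge : El x → V
      edge a = ⟅ node (pred a) , val a ⟆

      E : V
      E = set (El x) edge

      -- For the node u this is the neighbour u′ on the side of the root. The root x has none; its
      -- value x merely repeats the requirement that the new member differ from u.
      second : Node → Node
      second nothing  = nothing
      second (just a) = pred a

      -- An edge that contains u leads either up to the successor of u, which is `a`, or down to its
      -- predecessor, which is u′.
      neighbour : ∀ {a b y p} → p ≅ edge b → node (pred a) ε p → y ε p →
        ¬ (y ≅ node (pred a)) → ¬ (y ≅ node (second (pred a))) → y ≅ val a
      neighbour {a} {b} p≅ u∈ y∈ y≉u y≉u′ with ⟅⟆⁻ (≅→⊑ p≅ u∈) | ⟅⟆⁻ (≅→⊑ p≅ y∈)
      ... | inj₁ u≅ | inj₁ y≅ = contradiction (≅-trans y≅ (≅-sym u≅)) y≉u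
      ... | inj₂ u≅ | inj₂ y≅ = contradiction (≅-trans y≅ (≅-sym u≅)) y≉u
      ... | inj₁ u≅ | inj₂ y≅ =
        ≅-trans y≅ (≅-reflexive (cong val (sym (pred-injective (node-injective u≅)))))
      ... | inj₂ u≅ | inj₁ y≅ = contradiction
        (≅-trans y≅ (≅-reflexive (cong (λ v → node (second v)) (sym (node-injective {pred a} {just b} u≅))))) y≉u′

      second-< : ∀ u {n} → rank u ℕ.< suc n → rank (second u) ℕ.< suc n
      second-< nothing  l = l
      second-< (just a) l = ℕ.<-trans (pred-< a) l

      opaque
        first-missing : ∀ z {y} → x ε z → y ε x → ¬ (y ε z) → ∃ λ (a : El x) →
          ¬ (val a ε z) × node (pred a) ε z × node (second (pred a)) ε z
        first-missing z x∈z y∈x y∉z =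
          let (a , a∉z , least) = minimal (On.wellFounded # <-wellFounded) (λ a → ¬ (val a ε z))
                (toEl y∈x , λ p → y∉z (ε-respˡ (val-toEl y∈x) p))
              before : ∀ v → rank v ℕ.< suc (# a) → node v ε z
              before = λ { nothing _ → x∈z ; (just b) (s≤s l) → by-contradiction (least b l) }
          in a , a∉z , before (pred a) (pred-< a) , before (second (pred a)) (second-< (pred a) (pred-< a))

    set-↣ : ∀ {A : Set} {f : A → V} → A ↣ ℕ → El (set A f) ↣ El ω₁
    set-↣ e = ℕ↣ω₁ ↣-∘ (e ↣-∘ mk↣ {to = index} index-injective)

    Bool↣ℕ : Bool ↣ ℕ
    Bool↣ℕ = mk↣ {to = λ t → if t then 0 else 1}
      λ { {true} {true} _ → refl ; {false} {false} _ → refl }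

    module _ {x : V} (e : El x ↣ ℕ) (x∈H : x ε H) where
      open Path e

      opaque
        node∈H : ∀ u → node u ε H
        node∈H nothing  = x∈H
        node∈H (just a) = H-transitive (val-ε a) x∈H

        E∈H : E ε H
        E∈H = H-collect (λ { (mem a p) → ε-respˡ (≅-sym p) (edge∈H a) }) (set-↣ e)
          where
          edge∈H : ∀ a → edge a ε H
          edge∈H a = H-collect (λ { (mem true p)  → ε-respˡ (≅-sym p) (node∈H (pred a))
                                  ; (mem false p) → ε-respˡ (≅-sym p) (node∈H (just a)) }) (set-↣ Bool↣ℕ)

    next-node : ∀ {n} (y u u′ E x : Fin n) → Formula n
    next-node y u u′ E x = (y ∈̇ x) ∧̇ ((¬̇ (y ≐ u)) ∧̇ ((¬̇ (y ≐ u′)) ∧̇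
      (∃̇ ((zero ∈̇ suc E) ∧̇ ((suc u ∈̇ zero) ∧̇ (suc y ∈̇ zero))))))

    -- Free variables: E is 0 and x is 1; the quantified ones are z, y, u, u′.
    is-path : Formula 2
    is-path = ¬̇ (∃̇ ((2F ∈̇ 0F) ∧̇ ((∃̇ ((0F ∈̇ 3F) ∧̇ (¬̇ (0F ∈̇ 1F)))) ∧̇
      (¬̇ (∃̇ (∃̇ ((1F ∈̇ 2F) ∧̇ ((0F ∈̇ 2F) ∧̇
        ((∃̇ (next-node 0F 2F 1F 4F 5F)) ∧̇ (¬̇ (∃̇ (next-node 0F 2F 1F 4F 5F ∧̇ (0F ∈̇ 3F)))))))))))))

    module _ {x : V} (e : El x ↣ ℕ) {i k : Idx H} (i≅x : elt H i ≅ x) (k≅E : elt H k ≅ Path.E e) where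
      open Path e

      opaque
        next-node-exists : ∀ {z u u′ y p} (a : El x) → ¬ (val a ε elt H z) →
          node (pred a) ε elt H z → node (second (pred a)) ε elt H z →
          node (pred a) ≅ elt H u → node (second (pred a)) ≅ elt H u′ → val a ≅ elt H y → edge a ≅ elt H p →
          Sat (next-node 0F 2F 1F 4F 5F) (y ∷ᵥ u′ ∷ᵥ u ∷ᵥ z ∷ᵥ k ∷ᵥ i ∷ᵥ []ᵥ)
        next-node-exists a a∉z u∈z u′∈z u≅ u′≅ y≅ p≅ =
          ε→∈ (ε-respˡ y≅ (≅→⊑ (≅-sym i≅x) (val-ε a))) ,
          (λ q → a∉z (ε-respˡ (≅-trans u≅ (≅-trans (≅-sym (eq q)) (≅-sym y≅))) u∈z)) ,
          (λ q → a∉z (ε-respˡ (≅-trans u′≅ (≅-trans (≅-sym (eq q)) (≅-sym y≅))) u′∈z)) ,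
          _ , ε→∈ (≅→⊑ (≅-sym k≅E) (mem a (≅-sym p≅))) ,
          ε→∈ (≅→⊑ p≅ (mem true (≅-sym u≅))) ,
          ε→∈ (≅→⊑ p≅ (mem false (≅-sym y≅)))

        next-node-unique : ∀ {z u u′ y} (a : El x) →
          node (pred a) ≅ elt H u → node (second (pred a)) ≅ elt H u′ →
          Sat (next-node 0F 2F 1F 4F 5F) (y ∷ᵥ u′ ∷ᵥ u ∷ᵥ z ∷ᵥ k ∷ᵥ i ∷ᵥ []ᵥ) → elt H y ≅ val a
        next-node-unique a u≅ u′≅ (w∈ , w≉u , w≉u′ , q , q∈ , u∈q , w∈q) =
          let mem b q≅ = ≅→⊑ k≅E (∈→ε q∈)
          in neighbour q≅ (ε-respˡ (≅-sym u≅) (∈→ε u∈q)) (∈→ε w∈q)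
               (λ t → w≉u (un (≅-trans t u≅))) (λ t → w≉u′ (un (≅-trans t u′≅)))

        -- A set z that contains x and misses an element of x has a first missing element `a`. The
        -- two nodes before it are in z, and `a` is the only new member that they determine.
        path-is-path : x ε H → Sat is-path (k ∷ᵥ i ∷ᵥ []ᵥ)
        path-is-path x∈H (z , i∈z , (y , y∈i , y∉z) , none) =
          let (a , a∉z , u∈z , u′∈z) = first-missing (elt H z) (ε-respˡ i≅x (∈→ε i∈z)) (≅→⊑ i≅x (∈→ε y∈i)) (λ p → y∉z (ε→∈ p))
          in contradict a a∉z u∈z u′∈z (node∈H e x∈H (pred a)) (node∈H e x∈H (second (pred a)))
               (node∈H e x∈H (just a)) (H-transitive (mem a ≅-refl) (E∈H e x∈H))
          where
          contradict : ∀ a → ¬ (val a ε elt H z) → node (pred a) ε elt H z → node (second (pred a)) ε elt H z →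
            node (pred a) ε H → node (second (pred a)) ε H → val a ε H → edge a ε H → ⊥
          contradict a a∉z u∈z u′∈z (mem u u≅) (mem u′ u′≅) (mem y y≅) (mem p p≅) =
            none (u , u′ , ε→∈ (ε-respˡ u≅ u∈z) , ε→∈ (ε-respˡ u′≅ u′∈z) ,
              (y , next-node-exists a a∉z u∈z u′∈z u≅ u′≅ y≅ p≅) ,
              λ (w , next , w∈z) → a∉z (ε-respˡ (next-node-unique {z} a u≅ u′≅ next) (∈→ε w∈z)))

  opaque
    -- The hull contains some E with the property `is-path`, possibly not the path built from `e`.
    -- The property is applied to the set z of nodes in the hull, which is countable and hence in H.
    -- If z missed an element, some u and u′ in z would determine new members, all outside z; but a
    -- Skolem function yields one in the hull.
    countable-⊑ : ∀ {K x} → x ε Sk K → El x ↣ ℕ → x ⊑ Sk K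
    countable-⊑ {K} {x} x∈Sk@(mem (i , c) x≅i) e {w} w∈x = by-contradiction λ w∉Sk →
      let mem k k≅ = E∈H e (mem i x≅i)
          (E , cE , path) = skolem is-path (i ∷ᵥ []ᵥ) (λ { zero → c })
            (k , path-is-path e (≅-sym x≅i) (≅-sym k≅) (mem i x≅i))
          mem y y≅ = H-transitive w∈x (mem i x≅i)
          mem z z≅ = Z∈H
      in path (z , ε→∈ (ε-respˡ x≅i (≅→⊑ z≅ (∩⁺ {nodes} (mem nothing ≅-refl) x∈Sk)))
                 , (y , ε→∈ (ε-respˡ y≅ (≅→⊑ x≅i w∈x))
                      , λ y∈z → w∉Sk (proj₂ (∩⁻ nodes (Sk K) (≅→⊑ (≅-sym z≅) (ε-respˡ (≅-sym y≅) (∈→ε y∈z))))))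
                 , λ { (u , u′ , u∈z , u′∈z , next , fresh) →
                   let closed : ∀ {j} → elt H j ∈ elt H z → Closure K j
                       closed j∈z = Sk→Closure (proj₂ (∩⁻ nodes (Sk K) (≅→⊑ (≅-sym z≅) (∈→ε j∈z))))
                       (y₀ , c₀ , y₀∈x , rest) = skolem (next-node 0F 2F 1F 3F 4F) (u′ ∷ᵥ u ∷ᵥ E ∷ᵥ i ∷ᵥ []ᵥ)
                         (λ { 0F → closed u′∈z ; 1F → closed u∈z ; 2F → cE ; 3F → c }) next
                   in fresh (y₀ , (y₀∈x , rest) ,
                        ε→∈ (≅→⊑ z≅ (∩⁺ (element-node (≅→⊑ (≅-sym x≅i) (∈→ε y₀∈x))) (Closure→Sk c₀)))) })
      where
      open Path e using (nodes)
      element-node : ∀ {y} → y ε x → y ε nodes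
      element-node y∈x = mem (just (toEl y∈x)) (≅-sym (val-toEl y∈x))
      Z∈H : nodes ∩ Sk K ε H
      Z∈H = H-collect (λ p → Sk⊑H (proj₂ (∩⁻ nodes (Sk K) p)))
        (set-↣ (mk↣ {to = Path.rank e} (Path.rank-injective e)) ↣-∘ inclusion (λ p → proj₁ (∩⁻ nodes (Sk K) p)))

-- Models, closure points and cofinality

module Models (em : ExcludedMiddle (lsuc 0ℓ)) (ext : Extensionality (lsuc 0ℓ) (lsuc 0ℓ)) (S : Setting) where
  open Classical em ext
  open El
  open Setting S
  open Cardinals S
  open Hull S
  open Hulls em ext S

  record Model (K : V) : Set₁ where
    field
      ∈𝒴        : K ε 𝒴
      countable : El K ↣ ℕ
      ⊑ω₂       : K ⊑ ω₂
      Sk∩ω₂     : Sk K ∩ ω₂ ≅ K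

    Sk-⊒ : K ⊑ Sk K
    Sk-⊒ p = proj₁ (∩⁻ (Sk K) ω₂ (≅→⊑ (≅-sym Sk∩ω₂) p))

  opaque
    𝒳→Model : ∀ {K} → K ε 𝒳 → Model K
    𝒳→Model {K} (mem (j , sk , _) p) = record
      { ∈𝒴        = mem j p
      ; countable = ↣-from (proj₂ (proj₁ 𝒴-stationary j)) ↣-∘ inclusion (≅→⊑ p)
      ; ⊑ω₂       = λ q → ⊆→⊑ (proj₁ (proj₁ 𝒴-stationary j)) (≅→⊑ p q)
      ; Sk∩ω₂     = ⊑-antisym
          (λ q → let (q₁ , q₂) = ∩⁻ (Sk K) ω₂ q in
            ≅→⊑ (≅-trans (eq sk) (≅-sym p)) (∩⁺ (Sk-mono (≅→⊑ p) q₁) q₂))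
          (λ q → let (q₁ , q₂) = ∩⁻ (Sk (elt 𝒴 j)) ω₂ (≅→⊑ (≅-sym (eq {_} {elt 𝒴 j} sk)) (≅→⊑ p q)) in
            ∩⁺ (Sk-mono (≅→⊑ (≅-sym p)) q₁) q₂)
      }

    Sk-π : ∀ {K} → Model K → ∀ ξ → val ξ ε K → π⟨ ξ ⟩ ε Sk K
    Sk-π M ξ ξ∈K =
      let mem (i , c) p = Model.Sk-⊒ M ξ∈K
          i≅ξ = ≅-trans (≅-sym p) (val-index ξ)
          (y , c′ , (α , e , e′)) = skolem (π̇ 1F 0F) (i ∷ᵥ []ᵥ) (λ { 0F → c })
            (Bijection.to π (index ξ) , index ξ , un i≅ξ , ≈-refl {π⟨ ξ ⟩})
      in ε-respˡ (≅-trans (eq e′) (eq (Bijection.cong π (un (≅-trans (≅-sym (eq e)) i≅ξ))))) (Closure→Sk c′)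

    Sk-π⁻ : ∀ {K} → Model K → ∀ ξ → π⟨ ξ ⟩ ε Sk K → val ξ ε K
    Sk-π⁻ {K} M ξ (mem (i , c) p) =
      let mem k q = ω₂⊑H (val-ε ξ)
          (y , c′ , (α , e , e′)) = skolem (π̇ 0F 1F) (i ∷ᵥ []ᵥ) (λ { 0F → c })
            (k , index ξ , un (≅-trans (≅-sym q) (val-index ξ)) , un (≅-sym p))
          α≡ξ : toEl (elt-ε {ω₂} α) ≡ ξ
          α≡ξ = π-injective (≅-trans (π-toEl α) (≅-trans (≅-sym (eq e′)) (≅-sym p)))
          y≅ξ : elt H y ≅ val ξ
          y≅ξ = ≅-trans (eq e) (≅-trans (≅-sym (val-toEl (elt-ε {ω₂} α))) (≅-reflexive (cong val α≡ξ)))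
      in ≅→⊑ (Model.Sk∩ω₂ M) (∩⁺ (ε-respˡ y≅ξ (Closure→Sk c′)) (val-ε ξ))

  traces : El ω₂ → V
  traces γ = set (Idx 𝒴) (λ i → elt 𝒴 i ∩ val γ)

  trace-ε : ∀ {K} γ → K ε 𝒴 → K ∩ val γ ε traces γ
  trace-ε γ (mem j p) = mem j (∩-congˡ (val γ) p)

  opaque
    traces-small : ∀ γ → El (traces γ) ↣ El ω₁
    traces-small γ = ↣-fromEl {set (Idx 𝒴) (λ i → elt 𝒴 i ∩ elt ω₂ (index γ))} (𝒴-thin (index γ)) ↣-∘ inclusion
      (λ { (mem j p) → mem j (≅-trans p (∩-congʳ (elt 𝒴 j) (val-index γ))) })

  Closed : (El ω₂ → El ω₂ → Set) → V → Set
  Closed R δ = ∀ γ → val γ ε δ → ∃ λ (ξ : El ω₂) → val ξ ε δ × R γ ξ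

  module _ (R : El ω₂ → El ω₂ → Set) (total : ∀ γ → ∃ (R γ)) where

    private
      D : V
      D = ⟪ δ ∈ ω₂ ∣ Closed R δ ⟫

      opaque
        closing-step : ∀ (δ : El ω₂) → ∃ λ (δ′ : El ω₂) → val δ ε val δ′ ×
          (∀ (γ : El ω₂) → val γ ε val δ → ∃ λ (ξ : El ω₂) → val ξ ε val δ′ × R γ ξ)
        closing-step δ =
          let (ζ , bound) = ω₂.bounded {I = El (val δ)} (ω₂.enumerate δ)
                (λ γ ζ → ∃ λ (ξ : El ω₂) → val ξ ε val ζ × R (ω₂.below δ γ) ξ)
                (λ { s (ξ , p , r) → ξ , s p , r })
                (λ γ → let (ξ , r) = total (ω₂.below δ γ) in ω₂.next ξ , ξ , ω₂.<-next ξ , r)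
              (δ′ , δ<δ′ , ζ<δ′) = ω₂.∃-upper δ ζ
          in δ′ , δ<δ′ , λ γ γ<δ →
            let (ξ , ξ<ζ , r) = bound (toEl γ<δ)
            in ξ , Ord.transitive (ω₂.val-ord δ′) ξ<ζ ζ<δ′ , subst (λ γ → R γ ξ)
                 (val-injective (≅-trans (ω₂.val-below δ _) (val-toEl γ<δ))) r

      stage : El ω₂ → ℕ → El ω₂
      stage α zero    = α
      stage α (suc n) = proj₁ (closing-step (stage α n))

      opaque
        -- The least strict bound δ of the stages is closed: a γ below δ does not bound the stages,
        -- so it is at most some stage n, hence below stage n + 1, and its witness is below stage n
        -- + 2.
        above : ∀ (α : El ω₂) → ∃ λ (δ : El ω₂) → val α ε val δ × Closed R (val δ)
        above α =
          let Above : El ω₂ → Set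
              Above δ = ∀ n → val (stage α n) ε val δ
              (δ , α<δ , least) = minimal El-wellFounded Above
                (ω₂.bounded ℕ↣ω₁ (λ n δ → val (stage α n) ε val δ) (λ s p → s p) (λ n → ω₂.no-maximum _))
          in δ , α<δ zero , λ γ γ<δ →
            let (n , n≮γ) = by-contradiction λ ∄ → least γ γ<δ λ n → by-contradiction λ ∉ → ∄ (n , ∉)
                γ⊑n = ∌→⊑ (ω₂.val-ord γ) (ω₂.val-ord (stage α n)) n≮γ
                γ<n+1 : val γ ε val (stage α (suc n))
                γ<n+1 = by-contradiction λ ∉ → n≮γ
                  (∌→⊑ (ω₂.val-ord (stage α (suc n))) (ω₂.val-ord γ) ∉ (proj₁ (proj₂ (closing-step (stage α n)))))
                (ξ , ξ<n+2 , r) = proj₂ (proj₂ (closing-step (stage α (suc n)))) γ γ<n+1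
            in ξ , Ord.transitive (ω₂.val-ord δ) ξ<n+2 (α<δ (suc (suc n))) , r

        Closed-resp : ∀ {δ δ′} → δ ≅ δ′ → Closed R δ → Closed R δ′
        Closed-resp e c γ p = let (ξ , q , r) = c γ (≅→⊑ (≅-sym e) p) in ξ , ≅→⊑ e q , r

        D-club : IsClub ω₂ D
        D-club =
          (λ (i , _) → i , ≈-refl {elt ω₂ i}) ,
          (λ i → let (δ , p , c) = above (toEl (elt-ε i)) in
            (index δ , Closed-resp (val-index δ) c) ,
            ε→∈ (≅→⊑ (val-index δ) (ε-respˡ (val-toEl (elt-ε i)) p))) ,
          (λ β (_ , limit) →
            (β , λ γ γ<β →
              let mem k γ≅ = γ<β
                  ((d , closed) , k∈d , d∈β) = limit k
                  (ξ , ξ<d , r) = closed γ (ε-respˡ (≅-sym γ≅) (∈→ε k∈d))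
              in ξ , Ord.transitive (Ord-ε ω₂-ord (elt-ε β)) ξ<d (∈→ε d∈β) , r) ,
            ≈-refl {elt ω₂ β})

    opaque
      stationary-closed : ∀ {Γ} → IsStationary ω₂ Γ → ∃ λ (β : El ω₂) → val β ε Γ × Closed R (val β)
      stationary-closed {Γ} stationary =
        let (g , (i , c) , e) = stationary D D-club
            β = toEl (elt-ε {ω₂} i)
            β≅ = val-toEl (elt-ε {ω₂} i)
        in β , mem g (≅-trans β≅ (≅-sym (eq e))) , Closed-resp (≅-sym β≅) c

  -- For limit ordinals β this says that β has uncountable cofinality.
  BoundsCountable : V → Set₁
  BoundsCountable β = ∀ {I : Set} → I ↣ ℕ → (R : I → El β → Set) →
    (∀ {i ξ η} → val ξ ⊑ val η → R i ξ → R i η) → (∀ i → ∃ (R i)) → ∃ λ ξ → ∀ i → R i ξ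

  private
    module _ (b : V) (b-ord : Ord b) (cofinality : HasCofinality b ω₁) where

      open Σ (proj₁ cofinality) renaming (proj₁ to f; proj₂ to f-cofinal)
      module f = Func f

      restrict : (δ : Idx ω₁) → Idx (elt ω₁ δ) → Idx ω₁
      restrict δ j = idx (Ord.transitive ω₁-ord (elt-ε j) (elt-ε δ))

      restrict-≅ : ∀ δ j → elt (elt ω₁ δ) j ≅ elt ω₁ (restrict δ j)
      restrict-≅ δ j = is (Ord.transitive ω₁-ord (elt-ε j) (elt-ε δ))

      -- The witness for i is at most f(ζ i) for some ζ i in ω₁, and some δ in ω₁ exceeds all ζ i.
      -- As f restricted to δ is not cofinal, an ordinal γ not covered by it exceeds every f(ζ i).
      ω₁-cofinality : BoundsCountable b
      ω₁-cofinality {I} e R mono total = by-contradiction λ ∄ →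
        proj₂ cofinality (index δ)
          ( record
            { to   = λ j → f.to (restrict (index δ) j)
            ; cong = λ {j} {k} p → f.cong (un (≅-trans (≅-sym (restrict-≅ _ j)) (≅-trans (eq p) (restrict-≅ _ k))))
            }
          , λ γ → by-contradiction λ ∄j → ∄ (toEl (elt-ε γ) , λ i → mono (lower-bound γ ∄j i) (proj₂ (total i))))
        where
        ζ : I → Idx ω₁
        ζ i = proj₁ (f-cofinal (index (proj₁ (total i))))

        bound : ∃ λ (δ : El ω₁) → ∀ i → elt ω₁ (ζ i) ε val δ
        bound = ω₁.bounded e (λ i δ → elt ω₁ (ζ i) ε val δ) (λ s p → s p)
          (λ i → let (δ , p) = ω₁.no-maximum (toEl (elt-ε (ζ i))) in δ , ε-respˡ (val-toEl (elt-ε (ζ i))) p)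

        δ : El ω₁
        δ = proj₁ bound

        lower-bound : ∀ γ → ¬ (∃ λ j → elt b γ ⊆ elt b (f.to (restrict (index δ) j))) →
          ∀ i → val (proj₁ (total i)) ⊑ val (toEl (elt-ε {b} γ))
        lower-bound γ ∄j i p =
          let mem j q = ≅→⊑ (val-index δ) (proj₂ bound i)
              j′ = restrict (index δ) j
              ζ≅j = eq (f.cong (un (≅-trans q (restrict-≅ (index δ) j))))
              fj<γ : elt b (f.to j′) ε elt b γ
              fj<γ = by-contradiction λ ∉ → ∄j (j , ⊑→⊆ (∌→⊑ (Ord-ε b-ord (elt-ε γ)) (Ord-ε b-ord (elt-ε (f.to j′))) ∉))
              p′ = ⊆→⊑ (proj₂ (f-cofinal (index (proj₁ (total i))))) (≅→⊑ (val-index _) p)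
          in ≅→⊑ (≅-sym (val-toEl (elt-ε γ))) (Ord.transitive (Ord-ε b-ord (elt-ε γ)) (≅→⊑ ζ≅j p′) fj<γ)

  opaque
    BoundsCountable-resp : ∀ {β β′} → β ≅ β′ → BoundsCountable β → BoundsCountable β′
    BoundsCountable-resp {β} {β′} e bounds i R mono total =
      let (ξ , r) = bounds i (λ i ξ → R i (to ξ)) (λ {i} {ξ} {η} s → mono λ p →
              ≅→⊑ (≅-sym (val-to η)) (s (≅→⊑ (val-to ξ) p)))
            (λ i → let (η , r) = total i
                       p = ≅→⊑ (≅-sym e) (val-ε η)
                   in toEl p , mono (≅→⊑ (≅-sym (≅-trans (val-to (toEl p)) (val-toEl p)))) r)
      in to ξ , r
      where
      to : El β → El β′
      to ξ = toEl (≅→⊑ e (val-ε ξ))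
      val-to : ∀ ξ → val (to ξ) ≅ val ξ
      val-to ξ = val-toEl _

    Λ-bounds : ∀ {β} → β ε Λ → BoundsCountable β
    Λ-bounds (mem (b , cofinality , _) p) = BoundsCountable-resp (≅-sym p)
      (ω₁-cofinality (elt ω₂ b) (Ord-ε ω₂-ord (elt-ε b)) cofinality)

    Λ-limit : ∀ {β} → β ε Λ → ∀ {x} → x ε β → ∃ λ (γ : El β) → x ε val γ
    Λ-limit (mem (b , _ , (_ , limit)) p) x<β =
      let mem i q = ≅→⊑ p x<β
          (c , i∈c , c∈b) = limit i
          c<β = ≅→⊑ (≅-sym p) (∈→ε c∈b)
      in toEl c<β , ≅→⊑ (≅-sym (val-toEl c<β)) (ε-respˡ (≅-sym q) (∈→ε i∈c))

    Λ-element : ∀ {β} → β ε Λ → El β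
    Λ-element (mem (b , _ , (i , _)) p) = toEl (≅→⊑ (≅-sym p) (elt-ε i))

    ω₂-bounds : BoundsCountable ω₂
    ω₂-bounds e = ω₂.bounded (ℕ↣ω₁ ↣-∘ e)

-- Types of conditions, coded by elements of ω₁

module Codes (em : ExcludedMiddle (lsuc 0ℓ)) (ext : Extensionality (lsuc 0ℓ) (lsuc 0ℓ)) (S : Setting) (Γ : V) where
  open Classical em ext
  open El
  open Setting S
  open Cardinals S
  open Models em ext S
  open Forcing S Γ
  open Condition

  Finite→↣ℕ : ∀ {x} → Finite x → El x ↣ ℕ
  Finite→↣ℕ (_ , f) = mk↣ toℕ-injective ↣-∘ ↣-from f

  <-resp : ∀ {κ} (T : FiniteTree κ) {a a′ b b′} → a ≅ a′ → b ≅ b′ → FiniteTree._<_ T a b → FiniteTree._<_ T a′ b′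
  <-resp T {a} {a′} {b} {b′} (eq p) (eq q) l =
    let (respʳ , respˡ) = FiniteTree.<-resp-≈ T
    in respʳ {a′} {b} {b′} q (respˡ {b} {a} {a′} p l)

  Max-finite : ∀ p → Finite (Max p)
  Max-finite p = let (n , f) = finite p in n , record
    { to        = λ i → Injection.to f (proj₁ i)
    ; cong      = Injection.cong f
    ; injective = Injection.injective f
    }

  label-cong : ∀ p {i j} → max p i ≅ max p j → label p i ≅ label p j
  label-cong p (eq e) = eq (Injection.cong (F p) e)

  label-injective : ∀ p {i j} → label p i ≅ label p j → max p i ≅ max p j
  label-injective p (eq e) = eq (Injection.injective (F p) e)

  Mentioned : Condition → (V → Set) → Set
  Mentioned p P = (∀ j k → P (elt (elt (A p) j) k)) × (∀ i → P (label p i))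

  opaque
    -- Bounds are taken twice: over the elements of each model and over the labels, and then over
    -- these finitely many bounds. In the second round `nothing` stands for the labels.
    mentioned-bound : ∀ {β} → BoundsCountable β → ∀ p (P : V → El β → Set) →
      (∀ {x y ξ} → x ≅ y → P x ξ → P y ξ) → (∀ {x ξ η} → val ξ ⊑ val η → P x ξ → P x η) →
      (∀ x → x ε ω₂ → ∃ (P x)) → ∃ λ ξ → Mentioned p (λ x → P x ξ)
    mentioned-bound {β} bounds p P resp mono total =
      let (ξ , r) = bounds (mk↣ {to = number} λ {x} {y} → number-injective x y)
                     R R-mono (λ { (just M) → elements M ; nothing → labels })
      in ξ , (λ j k → let M = toEl (elt-ε {A p} j)
                          q = ≅→⊑ (≅-sym (val-toEl (elt-ε {A p} j))) (elt-ε k)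
                      in resp (val-toEl q) (r (just M) (toEl q)))
           , λ i → resp (label-cong p {index (toEl (elt-ε {Max p} i))} {i} (max-≅ i)) (r nothing (toEl (elt-ε i)))
      where
      A↣ℕ : El (A p) ↣ ℕ
      A↣ℕ = Finite→↣ℕ (A-finite p)

      number : Maybe (El (A p)) → ℕ
      number nothing  = zero
      number (just M) = suc (Injection.to A↣ℕ M)

      number-injective : ∀ x y → number x ≡ number y → x ≡ y
      number-injective (just _) (just _) e = cong just (Injection.injective A↣ℕ (ℕ.suc-injective e))
      number-injective nothing  nothing  _ = refl

      R : Maybe (El (A p)) → El β → Set
      R (just M) ξ = ∀ (x : El (val M)) → P (val x) ξ
      R nothing  ξ = ∀ (i : El (Max p)) → P (label p (index i)) ξ

      R-mono : ∀ {M ξ η} → val ξ ⊑ val η → R M ξ → R M η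
      R-mono {just _}  s r x = mono s (r x)
      R-mono {nothing} s r i = mono s (r i)

      elements : ∀ M → ∃ (R (just M))
      elements M = let model = 𝒳→Model (⊆→⊑ (proj₁ (A-adequate p)) (val-ε M)) in
        bounds (Model.countable model) (λ x ξ → P (val x) ξ) mono (λ x → total (val x) (Model.⊑ω₂ model (val-ε x)))

      labels : ∃ (R nothing)
      labels = bounds (Finite→↣ℕ (Max-finite p)) (λ i ξ → P (label p (index i)) ξ) mono (λ i → total _ (elt-ε _))

      max-≅ : ∀ i → max p (index (toEl (elt-ε {Max p} i))) ≅ max p i
      max-≅ i = ≅-trans (≅-sym (val-index _)) (val-toEl (elt-ε {Max p} i))

  opaque
    -- For each number `decide` fixes at most one index and value; functionality makes this the
    -- value at every index with that number.
    finite-image : ∀ x → Finite x → {Y : Set} (R : Idx x → Y → Set) →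
      (∀ {i j y z} → elt x i ≅ elt x j → R i y → R j z → y ≡ z) →
      ∃ λ (ys : List Y) → ∀ {i y} → R i y → y ∈ₗ ys
    finite-image x (n , f) {Y} R functional =
      concatMap hits (allFin n) ,
      λ {i} r → ∈-concatMap⁺ hits (Any.map (λ { refl → hit r }) (∈-allFin (Injection.to f i)))
      where
      hits : Fin n → List Y
      hits k with decide (Σ (Idx x × Y) λ (i , y) → Injection.to f i ≡ k × R i y)
      ... | yes ((_ , y) , _) = y ∷ []
      ... | no _              = []

      hit : ∀ {i y} → R i y → y ∈ₗ hits (Injection.to f i)
      hit {i} {y} r with decide (Σ (Idx x × Y) λ (j , z) → Injection.to f j ≡ Injection.to f i × R j z)
      ... | yes (_ , p , r′) = here (functional (≅-sym (eq (Injection.injective f p))) r r′)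
      ... | no ∄             = contradiction ((i , y) , refl , r) ∄

    List↣ω₁ : List (El ω₁) ↣ El ω₁
    List↣ω₁ = mk↣ {to = code} λ {xs} {ys} → injective xs ys
      where
      open Injection ω₁×ω₁↣ω₁ using () renaming (to to pair; injective to pair-injective)
      open Injection ω₁⊎ω₁↣ω₁ using () renaming (to to tag; injective to tag-injective)
      code : List (El ω₁) → El ω₁
      code []       = tag (inj₁ ω₁.element)
      code (x ∷ xs) = tag (inj₂ (pair (x , code xs)))

      injective : ∀ xs ys → code xs ≡ code ys → xs ≡ ys
      injective []       []       _ = refl
      injective []       (y ∷ ys) e with tag-injective e
      ... | ()
      injective (x ∷ xs) []       e with tag-injective e
      ... | ()
      injective (x ∷ xs) (y ∷ ys) e = let e′ = pair-injective (inj₂-injective (tag-injective e)) in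
        cong₂ _∷_ (cong proj₁ e′) (injective xs ys (cong proj₂ e′))

  Covered : (El ω₁ → Set) → Set
  Covered Q = ∃ λ ws → ∀ w → Q w → w ∈ₗ ws

  private
    members : ∀ Q → Covered Q → List (El ω₁)
    members Q (ws , _) = filter (λ w → decide (Q w)) ws

  -- The code depends on the covering list as well as on Q. What matters is that equal codes come
  -- from equal sets.
  set-code : ∀ Q → Covered Q → El ω₁
  set-code Q c = Injection.to List↣ω₁ (members Q c)

  opaque
    set-code-⊆ : ∀ {Q Q′} c c′ → set-code Q c ≡ set-code Q′ c′ → ∀ {w} → Q w → Q′ w
    set-code-⊆ {Q} {Q′} c c′ e {w} q = proj₂ (∈-filter⁻ (λ w → decide (Q′ w)) {xs = proj₁ c′}
      (subst (w ∈ₗ_) (Injection.injective List↣ω₁ e) (∈-filter⁺ (λ w → decide (Q w)) (proj₂ c w q) q)))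

  -- The relation is not symmetric: of the models it records what amalgamation takes from them, a
  -- copy in p of each model of q.
  record Same (γ : V) (p q : Condition) : Set₁ where
    field
      nodes≅  : nodes p ≅ nodes q
      <-to    : ∀ {a b} → _<_ p a b → _<_ q a b
      <-from  : ∀ {a b} → _<_ q a b → _<_ p a b
      graph-to   : ∀ i → label p i ε γ → Graph q (max p i) (label p i)
      graph-from : ∀ i → label q i ε γ → Graph p (max q i) (label q i)
      models  : ∀ j → ∃ λ k → elt (A p) k ∩ γ ≅ elt (A q) j ∩ γ

  private
    module Code (γ : El ω₂) where
      open Injection ω₁×ω₁↣ω₁ using () renaming (to to pair; injective to pair-injective)
      open Injection (ω₂.enumerate γ) using () renaming (to to ordinal; injective to ordinal-injective)
      open Injection (traces-small γ) using () renaming (to to trace; injective to trace-injective)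

      -- The four parts of the type as finite subsets of ω₁: nodes, order, labels below γ and traces
      -- on γ. Nodes already belong to ω₁; labels and traces are numbered through the size of γ and
      -- through thinness.
      Q₁ Q₂ Q₃ Q₄ : Condition → El ω₁ → Set
      Q₁ p w = val w ε nodes p
      Q₂ p w = ∃ λ u → ∃ λ v → w ≡ pair (u , v) × _<_ p (val u) (val v)
      Q₃ p w = ∃ λ u → ∃ λ v → w ≡ pair (u , ordinal v) × Graph p (val u) (val v)
      Q₄ p w = ∃ λ t → w ≡ trace t × ∃ λ j → elt (A p) j ∩ val γ ≅ val t

      opaque
        Q₁-covered : ∀ p → Covered (Q₁ p)
        Q₁-covered p =
          let (ws , c) = finite-image (nodes p) (finite p) (λ i w → elt (nodes p) i ≅ val w)
                (λ e a b → val-injective (≅-trans (≅-sym a) (≅-trans e b)))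
          in ws , λ w (mem i e) → c (≅-sym e)

        Q₂-covered : ∀ p → Covered (Q₂ p)
        Q₂-covered p =
          let (ws , c) = Q₁-covered p
          in map pair (cartesianProduct ws ws) , λ { w (u , v , refl , l) →
               let (a , b) = <⇒nodes p l
               in ∈-map⁺ pair (∈-cartesianProduct⁺ (c u (∈→ε a)) (c v (∈→ε b))) }

        Q₃-covered : ∀ p → Covered (Q₃ p)
        Q₃-covered p =
          let (ws , c) = Q₁-covered p
              (vs , d) = finite-image (Max p) (Max-finite p) (λ i (v : El (val γ)) → label p i ≅ val v)
                (λ {i} {j} e a b → val-injective (≅-trans (≅-sym a) (≅-trans (label-cong p {i} {j} e) b)))
          in map (λ (u , v) → pair (u , ordinal v)) (cartesianProduct ws vs) , λ { w (u , v , refl , (i , e , f)) →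
               ∈-map⁺ _ (∈-cartesianProduct⁺ (c u (mem (proj₁ i) (eq e))) (d {i} (≅-sym (eq f)))) }

        Q₄-covered : ∀ p → Covered (Q₄ p)
        Q₄-covered p =
          let (ts , c) = finite-image (A p) (A-finite p) (λ j (t : El (traces γ)) → elt (A p) j ∩ val γ ≅ val t)
                (λ e a b → val-injective (≅-trans (≅-sym a) (≅-trans (∩-congˡ (val γ) e) b)))
          in map trace ts , λ { w (t , refl , j , e) → ∈-map⁺ trace (c e) }

      code : Condition → El ω₁
      code p = pair (set-code (Q₁ p) (Q₁-covered p) , pair (set-code (Q₂ p) (Q₂-covered p) ,
                 pair (set-code (Q₃ p) (Q₃-covered p) , set-code (Q₄ p) (Q₄-covered p))))

      module _ (p q : Condition) (e : code p ≡ code q) where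

        private
          e₁ = pair-injective e
          e₂ = pair-injective (cong proj₂ e₁)
          e₃ = pair-injective (cong proj₂ e₂)

        Q₁⊆ : ∀ {w} → Q₁ p w → Q₁ q w
        Q₁⊆ = set-code-⊆ (Q₁-covered p) (Q₁-covered q) (cong proj₁ e₁)
        Q₂⊆ : ∀ {w} → Q₂ p w → Q₂ q w
        Q₂⊆ = set-code-⊆ (Q₂-covered p) (Q₂-covered q) (cong proj₁ e₂)
        Q₃⊆ : ∀ {w} → Q₃ p w → Q₃ q w
        Q₃⊆ = set-code-⊆ (Q₃-covered p) (Q₃-covered q) (cong proj₁ e₃)
        Q₄⊆ : ∀ {w} → Q₄ p w → Q₄ q w
        Q₄⊆ = set-code-⊆ (Q₄-covered p) (Q₄-covered q) (cong proj₂ e₃)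

        node-ε : ∀ {a} → a ε nodes p → a ε ω₁
        node-ε = ⊆→⊑ (nodes⊆ω₁ p)

        opaque
          nodes-⊑ : nodes p ⊑ nodes q
          nodes-⊑ a = ε-respˡ (val-toEl (node-ε a)) (Q₁⊆ (ε-respˡ (≅-sym (val-toEl (node-ε a))) a))

          <-⊆ : ∀ {a b} → _<_ p a b → _<_ q a b
          <-⊆ {a} {b} l =
            let (a∈ , b∈) = <⇒nodes p l
                a≅ = val-toEl (node-ε (∈→ε {y = nodes p} a∈))
                b≅ = val-toEl (node-ε (∈→ε {y = nodes p} b∈))
                (u , v , e , l′) = Q₂⊆ (toEl _ , toEl _ , refl , <-resp (T p) (≅-sym a≅) (≅-sym b≅) l)
                e′ = pair-injective e
            in <-resp (T q) (≅-trans (≅-reflexive (cong val (sym (cong proj₁ e′)))) a≅)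
                            (≅-trans (≅-reflexive (cong val (sym (cong proj₂ e′)))) b≅) l′

          graph-⊆ : ∀ i → label p i ε val γ → Graph q (max p i) (label p i)
          graph-⊆ i l =
            let a≅ = val-toEl (node-ε (elt-ε {nodes p} (proj₁ i)))
                b≅ = val-toEl l
                (u , v , e , (k , f , g)) = Q₃⊆ (toEl _ , toEl l , refl , (i , un a≅ , un b≅))
                e′ = pair-injective e
            in k , un (≅-trans (≅-sym a≅) (≅-trans (≅-reflexive (cong val (cong proj₁ e′))) (eq f)))
                 , un (≅-trans (≅-sym b≅) (≅-trans (≅-reflexive (cong val (ordinal-injective (cong proj₂ e′)))) (eq g)))

          models-⊆ : ∀ j → ∃ λ k → elt (A q) k ∩ val γ ≅ elt (A p) j ∩ val γ
          models-⊆ j =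
            let M = elt (A p) j
                t = trace-ε γ (Model.∈𝒴 (𝒳→Model (⊆→⊑ (proj₁ (A-adequate p)) (elt-ε {A p} j))))
                (u , e , k , f) = Q₄⊆ (toEl t , refl , j , ≅-sym (val-toEl t))
            in k , ≅-trans f (≅-trans (≅-reflexive (cong val (sym (trace-injective e)))) (val-toEl t))

  code : El ω₂ → Condition → El ω₁
  code γ p = Code.code γ p

  opaque
    code-same : ∀ γ p q → code γ p ≡ code γ q → Same (val γ) p q
    code-same γ p q e = record
      { nodes≅     = ⊑-antisym (Code.nodes-⊑ γ p q e) (Code.nodes-⊑ γ q p (sym e))
      ; <-to       = Code.<-⊆ γ p q e
      ; <-from     = Code.<-⊆ γ q p (sym e)
      ; graph-to   = Code.graph-⊆ γ p q e
      ; graph-from = Code.graph-⊆ γ q p (sym e)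
      ; models     = Code.models-⊆ γ q p (sym e)
      }

-- Comparison points and adequacy

⋃⁺ : ∀ {x y z} → y ε x → z ε y → z ε ⋃ x
⋃⁺ (mem i p) q = let mem j q′ = ≅→⊑ p q in mem (i , j) q′

infixl 6 _∪_

_∪_ : V → V → V
x ∪ y = set (Idx x ⊎ Idx y) [ elt x , elt y ]

∪⁺ˡ : ∀ x y {z} → z ε x → z ε x ∪ y
∪⁺ˡ x y (mem i p) = mem (inj₁ i) p

∪⁺ʳ : ∀ x y {z} → z ε y → z ε x ∪ y
∪⁺ʳ x y (mem j p) = mem (inj₂ j) p

module Comparison (em : ExcludedMiddle (lsuc 0ℓ)) (ext : Extensionality (lsuc 0ℓ) (lsuc 0ℓ))
  (S : Setting) (Γ : V) (Γ⊑ω₂ : Γ ⊑ Setting.ω₂ S) where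
  open Classical em ext
  open El
  open Setting S
  open Cardinals S
  open Hull S
  open Hulls em ext S
  open Models em ext S
  open Adequacy S Γ

  ∈ω₂→Ord : ∀ {x} → x ε ω₂ → Ord x
  ∈ω₂→Ord = Ord-ε ω₂-ord

  Γ→Ord : ∀ {x} → x ε Γ → Ord x
  Γ→Ord p = ∈ω₂→Ord (Γ⊑ω₂ p)

  transitive : ∀ {x y z} → x ε ω₂ → z ε y → y ε x → z ε x
  transitive p = Ord.transitive (∈ω₂→Ord p)

  -- Membership in `Γ⟨ M ⟩` with the supremum unfolded: it is at most γ if and only if each element
  -- of M ∩ β is.
  record IsΓ (M β : V) : Set₁ where
    field
      ∈Γ  : β ε Γ
      gap : ∀ {γ} → γ ε Γ → (∀ {x} → x ε M → x ε β → x ⊑ γ) → ¬ (γ ε β)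

  opaque
    Γ⟨⟩⁻ : ∀ M {β} → β ε Γ⟨ M ⟩ → IsΓ M β
    Γ⟨⟩⁻ M {β} (mem (b , gap) p) = record
      { ∈Γ  = mem b p
      ; gap = λ { {γ} (mem g q) bound γ<β → gap g
          ( (λ { ((x , x<b) , j) → ε→∈ (≅→⊑ q (bound (elt-ε {M} x) (≅→⊑ (≅-sym p) (∈→ε x<b)) (elt-ε {elt M x} j))) })
          , ε→∈ (≅→⊑ p (ε-respˡ q γ<β))) }
      }

    Γ⟨⟩⁺ : ∀ M {β} → IsΓ M β → β ε Γ⟨ M ⟩
    Γ⟨⟩⁺ M {β} record { ∈Γ = mem b p ; gap = gap } = mem
      (b , λ g (s , g<b) → gap (elt-ε {Γ} g)
        (λ {x} x∈M x<β z → ⊆→⊑ s (⋃⁺ {M ∩ elt Γ b} (∩⁺ x∈M (≅→⊑ p x<β)) z))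
        (≅→⊑ (≅-sym p) (∈→ε g<b))) p

  record Largest (M N β : V) : Set₁ where
    field
      isΓˡ    : IsΓ M β
      isΓʳ    : IsΓ N β
      largest : ∀ {δ} → IsΓ M δ → IsΓ N δ → δ ⊑ β

  opaque
    Largest-to : ∀ M N {β} → Largest M N β → IsComparisonPoint M N β
    Largest-to M N {β} l =
      ε→∈ (∩⁺ {Γ⟨ M ⟩} (Γ⟨⟩⁺ M isΓˡ) (Γ⟨⟩⁺ N isΓʳ)) ,
      λ i → let (p , q) = ∩⁻ Γ⟨ M ⟩ Γ⟨ N ⟩ (elt-ε i) in ⊑→⊆ (largest (Γ⟨⟩⁻ M p) (Γ⟨⟩⁻ N q))
      where open Largest l

    Largest-from : ∀ M N {β} → IsComparisonPoint M N β → Largest M N β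
    Largest-from M N {β} (β∈ , max) = let (p , q) = ∩⁻ Γ⟨ M ⟩ Γ⟨ N ⟩ (∈→ε β∈) in record
      { isΓˡ    = Γ⟨⟩⁻ M p
      ; isΓʳ    = Γ⟨⟩⁻ N q
      ; largest = λ a b → bounded (∩⁺ {Γ⟨ M ⟩} {Γ⟨ N ⟩} (Γ⟨⟩⁺ M a) (Γ⟨⟩⁺ N b))
      }
      where
      bounded : ∀ {δ} → δ ε Γ⟨ M ⟩ ∩ Γ⟨ N ⟩ → δ ⊑ β
      bounded (mem i p) z = ⊆→⊑ (max i) (≅→⊑ p z)

    -- The least element of Γ above all of Γ_M ∩ Γ_N is a member: a smaller
    -- element of Γ is exceeded by some member, whose gap it respects.
    largest-exists : ∀ M N α → α ε Γ → (∀ {δ} → IsΓ M δ → IsΓ N δ → δ ⊑ α) →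
      ∃ λ (β : El Γ) → Largest M N (val β)
    largest-exists M N α α∈Γ bound =
      let (β , above , least) = minimal El-wellFounded Above (toEl α∈Γ , λ d →
            ⊑→⊆ (λ z → ≅→⊑ (≅-sym (val-toEl α∈Γ)) (bound (proj₁ (common d)) (proj₂ (common d)) z)))
      in β , record
        { isΓˡ    = member M β above least (λ d → proj₁ (common d))
        ; isΓʳ    = member N β above least (λ d → proj₂ (common d))
        ; largest = λ a b z →
            let d∈ = ∩⁺ {Γ⟨ M ⟩} {Γ⟨ N ⟩} (Γ⟨⟩⁺ M a) (Γ⟨⟩⁺ N b)
            in ⊆→⊑ (above (toEl d∈)) (≅→⊑ (≅-sym (val-toEl d∈)) z)
        }
      where
      Common : V
      Common = Γ⟨ M ⟩ ∩ Γ⟨ N ⟩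

      common : (d : El Common) → IsΓ M (val d) × IsΓ N (val d)
      common d = let (p , q) = ∩⁻ Γ⟨ M ⟩ Γ⟨ N ⟩ (val-ε d) in Γ⟨⟩⁻ M p , Γ⟨⟩⁻ N q

      Above : El Γ → Set
      Above β = ∀ (d : El Common) → val d ⊆ val β

      member : ∀ K (β : El Γ) → Above β → (∀ (γ : El Γ) → val γ ε val β → ¬ Above γ) → (∀ (d : El Common) → IsΓ K (val d)) → IsΓ K (val β)
      member K β above least isΓ = record
        { ∈Γ  = val-ε β
        ; gap = λ {γ} γ∈Γ bounded γ<β → least (toEl γ∈Γ) (ε-respˡ (≅-sym (val-toEl γ∈Γ)) γ<β) λ d →
            ⊑→⊆ λ z → ≅→⊑ (≅-sym (val-toEl γ∈Γ))
              (∌→⊑ (Γ→Ord (IsΓ.∈Γ (isΓ d))) (Γ→Ord γ∈Γ)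
                (IsΓ.gap (isΓ d) γ∈Γ (λ x∈K x<d → bounded x∈K (⊆→⊑ (above d) x<d))) z)
        }

    -- With ρ the least element of L not below ζ, K ∩ ζ is (K ∩ β) ∩ ρ.
    Sk-initial : ∀ {K L β ζ} → Model K → Model L → IsΓ L β → K ∩ β ε Sk L → ζ ε Γ → ζ ⊑ β → K ∩ ζ ε Sk L
    Sk-initial {K} {L} {β} {ζ} K-model L-model β-isΓ K∩β∈Sk ζ∈Γ ζ⊑β
      with trichotomy (Γ→Ord ζ∈Γ) (Γ→Ord (IsΓ.∈Γ β-isΓ))
    ... | inj₂ (inj₁ ζ≅β) = ε-respˡ (∩-congʳ K (≅-sym ζ≅β)) K∩β∈Sk
    ... | inj₂ (inj₂ β<ζ) = contradiction β<ζ (⊑→∌ ζ⊑β)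
    ... | inj₁ ζ<β = ε-respˡ same (Sk-∩ K∩β∈Sk (Model.Sk-⊒ L-model (val-ε ρ)))
      where
      ordL : ∀ {x} → x ε L → Ord x
      ordL p = ∈ω₂→Ord (Model.⊑ω₂ L-model p)

      -- L has an element in [ζ, β), for otherwise ζ would be an element of Γ in the gap below β.
      w : ∃ λ (w : El L) → val w ε β × ¬ (val w ε ζ)
      w = by-contradiction λ ∄ → IsΓ.gap β-isΓ ζ∈Γ
        (λ {x} x∈L x<β z → Ord.transitive (Γ→Ord ζ∈Γ) z (by-contradiction λ x≮ζ → ∄
          (toEl x∈L , ε-respˡ (≅-sym (val-toEl x∈L)) x<β , λ q → x≮ζ (ε-respˡ (val-toEl x∈L) q)))) ζ<β

      least : ∃ λ (ρ : El L) → ¬ (val ρ ε ζ) × (∀ (b : El L) → val b ε val ρ → ¬ ¬ (val b ε ζ))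
      least = minimal El-wellFounded (λ ρ → ¬ (val ρ ε ζ)) (proj₁ w , proj₂ (proj₂ w))

      ρ : El L
      ρ = proj₁ least

      ζ⊑ρ : ζ ⊑ val ρ
      ζ⊑ρ = ∌→⊑ (Γ→Ord ζ∈Γ) (ordL (val-ε ρ)) (proj₁ (proj₂ least))

      same : (K ∩ β) ∩ val ρ ≅ K ∩ ζ
      same = ⊑-antisym
        (λ {x} p → let (x∈K∩β , x<ρ) = ∩⁻ (K ∩ β) (val ρ) p
                       x∈K = proj₁ (∩⁻ K β x∈K∩β)
                       -- K ∩ β is countable, so its elements lie in the hull and hence in L, where
                       -- minimality of ρ applies to them.
                       x∈Sk = countable-⊑ K∩β∈Sk (Model.countable K-model ↣-∘ inclusion (λ q → proj₁ (∩⁻ K β q))) x∈K∩β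
                       x∈L = ≅→⊑ (Model.Sk∩ω₂ L-model) (∩⁺ x∈Sk (Model.⊑ω₂ K-model x∈K))
                       x<ζ = by-contradiction λ x≮ζ → proj₂ (proj₂ least) (toEl x∈L)
                               (ε-respˡ (≅-sym (val-toEl x∈L)) x<ρ) (λ q → x≮ζ (ε-respˡ (val-toEl x∈L) q))
                   in ∩⁺ x∈K x<ζ)
        (λ {x} p → let (x∈K , x<ζ) = ∩⁻ K ζ p in ∩⁺ (∩⁺ x∈K (ζ⊑β x<ζ)) (ζ⊑ρ x<ζ))

  record Compared (M N β : V) : Set₁ where
    field
      point : Largest M N β
      cases : M ∩ β ≅ N ∩ β ⊎ M ∩ β ε Sk N ⊎ N ∩ β ε Sk M

  opaque
    Compared-sym : ∀ {M N β} → Compared M N β → Compared N M β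
    Compared-sym c = record
      { point = record { isΓˡ = isΓʳ ; isΓʳ = isΓˡ ; largest = λ a b → largest b a }
      ; cases = swap (Compared.cases c)
      }
      where
      open Largest (Compared.point c)
      swap : ∀ {a b : V} {P Q : Set} → a ≅ b ⊎ P ⊎ Q → b ≅ a ⊎ Q ⊎ P
      swap (inj₁ e)        = inj₁ (≅-sym e)
      swap (inj₂ (inj₁ p)) = inj₂ (inj₂ p)
      swap (inj₂ (inj₂ p)) = inj₂ (inj₁ p)

  -- M and M′ belong to the condition at α and N to the one at β; as the two
  -- conditions look the same below γ, N has a copy M′ there.
  module _ {M N M′ α β γ β′ : V} (M-model : Model M) (N-model : Model N) (M′-model : Model M′)
    (α∈Γ : α ε Γ) (β∈Γ : β ε Γ) (γ<α : γ ε α) (α<β : α ε β)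
    (thin : ∀ {ζ} → ζ ε α → ∀ η → π⟨ η ⟩ ≅ M ∩ ζ → val η ε α)
    (M⊑β : M ⊑ β) (M-low : ∀ {x} → x ε M → x ε α → x ε γ) (M′-low : ∀ {x} → x ε M′ → x ε α → x ε γ)
    (N-low : ∀ {x} → x ε N → x ε β → x ε γ) (M′≅N : M′ ∩ γ ≅ N ∩ γ) (compared : Compared M M′ β′) where

    private
      open Compared compared using () renaming (point to point′; cases to cases′)

      α⊑β : α ⊑ β
      α⊑β p = Ord.transitive (Γ→Ord β∈Γ) p α<β

      opaque
        -- As M lies below β, the gap of δ for M excludes β < δ. Then N ∩ δ lies below γ < α, and
        -- the gap of δ for N excludes α < δ.
        below-α : ∀ {δ} → IsΓ M δ → IsΓ N δ → δ ⊑ α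
        below-α {δ} δ-isΓ-M δ-isΓ-N = ∌→⊑ ordδ (Γ→Ord α∈Γ) α≮δ
          where
          ordδ : Ord δ
          ordδ = Γ→Ord (IsΓ.∈Γ δ-isΓ-M)
          β≮δ : ¬ (β ε δ)
          β≮δ = IsΓ.gap δ-isΓ-M β∈Γ (λ x∈M _ z → Ord.transitive (Γ→Ord β∈Γ) z (M⊑β x∈M))
          α≮δ : ¬ (α ε δ)
          α≮δ = IsΓ.gap δ-isΓ-N α∈Γ (λ x∈N x<δ z →
            Ord.transitive (Γ→Ord α∈Γ) z (Ord.transitive (Γ→Ord α∈Γ)
              (N-low x∈N (∌→⊑ ordδ (Γ→Ord β∈Γ) β≮δ x<δ)) γ<α))

        largest : ∃ λ (ζ : El Γ) → Largest M N (val ζ)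
        largest = largest-exists M N α α∈Γ below-α

      ζ : V
      ζ = val (proj₁ largest)

      point : Largest M N ζ
      point = proj₂ largest
      open Largest point using (isΓˡ; isΓʳ)

      ζ⊑α : ζ ⊑ α
      ζ⊑α = below-α isΓˡ isΓʳ

      M′→N : ∀ {x} → x ε M′ → x ε α → x ε N
      M′→N x∈M′ x<α = proj₁ (∩⁻ N γ (≅→⊑ M′≅N (∩⁺ x∈M′ (M′-low x∈M′ x<α))))

      N→M′ : ∀ {x} → x ε N → x ε α → x ε M′
      N→M′ x∈N x<α = proj₁ (∩⁻ M′ γ (≅→⊑ (≅-sym M′≅N) (∩⁺ x∈N (N-low x∈N (α⊑β x<α)))))

      M′∩ζ≅N∩ζ : M′ ∩ ζ ≅ N ∩ ζ
      M′∩ζ≅N∩ζ = ⊑-antisym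
        (λ p → let (q , r) = ∩⁻ M′ ζ p in ∩⁺ (M′→N q (ζ⊑α r)) r)
        (λ p → let (q , r) = ∩⁻ N ζ p in ∩⁺ (N→M′ q (ζ⊑α r)) r)

      -- M′ and N have the same elements below ζ, so the gap for N is a gap for M′. This puts ζ
      -- among the ordinals of which β′ is the largest.
      ζ-isΓ-M′ : IsΓ M′ ζ
      ζ-isΓ-M′ = record
        { ∈Γ  = IsΓ.∈Γ isΓʳ
        ; gap = λ γ∈Γ bound → IsΓ.gap isΓʳ γ∈Γ (λ x∈N x<ζ → bound (N→M′ x∈N (ζ⊑α x<ζ)) x<ζ)
        }

      ζ⊑β′ : ζ ⊑ β′
      ζ⊑β′ = Largest.largest point′ isΓˡ ζ-isΓ-M′

      opaque
        -- `thin` speaks of ordinals strictly below α. If ζ is α itself, M ∩ ζ equals M ∩ γ, and γ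
        -- is below α.
        M∩ζ-code-low : ∀ ξ → π⟨ ξ ⟩ ≅ M ∩ ζ → val ξ ε α
        M∩ζ-code-low ξ e = [ (λ ζ<α → thin ζ<α ξ e) , [ equal , (λ α<ζ → contradiction α<ζ (⊑→∌ ζ⊑α)) ] ]
          (trichotomy (Γ→Ord (IsΓ.∈Γ isΓˡ)) (Γ→Ord α∈Γ))
          where
          equal : ζ ≅ α → val ξ ε α
          equal ζ≅α = thin γ<α ξ (≅-trans e (⊑-antisym
            (λ p → let (q , r) = ∩⁻ M ζ p in ∩⁺ q (M-low q (≅→⊑ ζ≅α r)))
            (λ p → let (q , r) = ∩⁻ M γ p in
              ∩⁺ q (≅→⊑ (≅-sym ζ≅α) (Ord.transitive (Γ→Ord α∈Γ) r γ<α)))))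

        transfer : M ∩ ζ ε Sk M′ → M ∩ ζ ε Sk N
        transfer p =
          let (ξ , e) = π-surjective (Sk⊑H p)
              ξ∈M′ = Sk-π⁻ M′-model ξ (ε-respˡ (≅-sym e) p)
          in ε-respˡ e (Sk-π N-model ξ (M′→N ξ∈M′ (M∩ζ-code-low ξ e)))

        ζ-cases : M ∩ β′ ≅ M′ ∩ β′ ⊎ M ∩ β′ ε Sk M′ ⊎ M′ ∩ β′ ε Sk M →
                  M ∩ ζ ≅ N ∩ ζ ⊎ M ∩ ζ ε Sk N ⊎ N ∩ ζ ε Sk M
        ζ-cases (inj₁ e) = inj₁ (≅-trans (⊑-antisym
          (λ p → let (q , r) = ∩⁻ M ζ p in ∩⁺ (proj₁ (∩⁻ M′ β′ (≅→⊑ e (∩⁺ q (ζ⊑β′ r))))) r)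
          (λ p → let (q , r) = ∩⁻ M′ ζ p in ∩⁺ (proj₁ (∩⁻ M β′ (≅→⊑ (≅-sym e) (∩⁺ q (ζ⊑β′ r))))) r)) M′∩ζ≅N∩ζ)
        ζ-cases (inj₂ (inj₁ p)) = inj₂ (inj₁ (transfer
          (Sk-initial M-model M′-model (Largest.isΓʳ point′) p (IsΓ.∈Γ isΓˡ) ζ⊑β′)))
        ζ-cases (inj₂ (inj₂ p)) = inj₂ (inj₂ (ε-respˡ M′∩ζ≅N∩ζ
          (Sk-initial M′-model M-model (Largest.isΓˡ point′) p (IsΓ.∈Γ isΓˡ) ζ⊑β′)))

    compare-through : ∃ λ (ζ : El Γ) → Compared M N (val ζ)
    compare-through = proj₁ largest , record { point = point ; cases = ζ-cases cases′ }

-- Amalgamation of two conditions of the same type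

module Amalgamation (em : ExcludedMiddle (lsuc 0ℓ)) (ext : Extensionality (lsuc 0ℓ) (lsuc 0ℓ))
  (S : Setting) (Γ : V) (Γ⊑ω₂ : Γ ⊑ Setting.ω₂ S) where
  open Classical em ext
  open El
  open Setting S
  open Cardinals S
  open Hull S
  open Hulls em ext S
  open Models em ext S
  open Adequacy S Γ
  open Comparison em ext S Γ Γ⊑ω₂
  open Codes em ext S Γ
  open Forcing S Γ
  open Condition

  opaque
    -- An element may have an index on either side of the union. Its number has to depend on the
    -- element alone, so the side is chosen by `respecting-choice`.
    ∪-finite : ∀ x y → Finite x → Finite y → Finite (x ∪ y)
    ∪-finite x y (m , f) (n , g) =
      let (h , correct , respects) = respecting-choice (λ s t → elt (x ∪ y) s ≅ elt (x ∪ y) t) Code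
            (λ _ _ → decide _) (λ {s} {t} {k} e → Code-resp {s} {t} k e) (λ {s} {t} {k} e → Code-resp {t} {s} k (≅-sym e))
            λ { (inj₁ i) → inj₁ (f.to i) , i , refl , ≅-refl ; (inj₂ j) → inj₂ (g.to j) , j , refl , ≅-refl }
      in m + n , record
        { to        = λ s → join m n (h s)
        ; cong      = λ e → cong (join m n) (respects (eq e))
        ; injective = λ {s} {t} e → un (Code-functional (h s) (correct s)
            (subst (Code t) (sym (join-injective (h s) (h t) e)) (correct t)))
        }
      where
      module f = Injection f
      module g = Injection g

      Code : Idx (x ∪ y) → Fin m ⊎ Fin n → Set
      Code s (inj₁ k) = ∃ λ i → f.to i ≡ k × elt x i ≅ elt (x ∪ y) s
      Code s (inj₂ k) = ∃ λ j → g.to j ≡ k × elt y j ≅ elt (x ∪ y) s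

      Code-resp : ∀ {s t} k → elt (x ∪ y) s ≅ elt (x ∪ y) t → Code s k → Code t k
      Code-resp (inj₁ k) e (i , p , q) = i , p , ≅-trans q e
      Code-resp (inj₂ k) e (j , p , q) = j , p , ≅-trans q e

      Code-functional : ∀ {s t} k → Code s k → Code t k → elt (x ∪ y) s ≅ elt (x ∪ y) t
      Code-functional (inj₁ k) (i , p , q) (j , p′ , q′) =
        ≅-trans (≅-sym q) (≅-trans (eq (f.injective (trans p (sym p′)))) q′)
      Code-functional (inj₂ k) (i , p , q) (j , p′ , q′) =
        ≅-trans (≅-sym q) (≅-trans (eq (g.injective (trans p (sym p′)))) q′)

      join-injective : ∀ a b → join m n a ≡ join m n b → a ≡ b
      join-injective a b e = trans (sym (splitAt-join m n a)) (trans (cong (splitAt m) e) (splitAt-join m n b))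

  module Amalgam (p q : Condition) {α β γ : V} (α∈Γ : α ε Γ) (β∈Γ : β ε Γ) (γ<α : γ ε α) (α<β : α ε β)
    (thin : ∀ {M ζ} → M ε 𝒴 → ζ ε α → ∀ η → π⟨ η ⟩ ≅ M ∩ ζ → val η ε α)
    (p-low : Mentioned p (λ x → x ε α → x ε γ)) (q-low : Mentioned q (λ x → x ε β → x ε γ))
    (p-below : Mentioned p (λ x → x ε β)) (same : Same γ p q) where

    open Same same

    model-in : ∀ r {M} → M ε A r → Model M
    model-in r M∈A = 𝒳→Model (⊆→⊑ (proj₁ (A-adequate r)) M∈A)

    mentioned : ∀ r {P : V → Set} → (∀ {x y} → x ≅ y → P x → P y) → Mentioned r P →
      ∀ j {x} → x ε elt (A r) j → P x
    mentioned r resp (m , _) j (mem k e) = resp (≅-sym e) (m j k)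

    p-model-low : ∀ j {x} → x ε elt (A p) j → x ε α → x ε γ
    p-model-low = mentioned p {λ x → x ε α → x ε γ} (λ e f l → ε-respˡ e (f (ε-respˡ (≅-sym e) l))) p-low

    q-model-low : ∀ k {x} → x ε elt (A q) k → x ε β → x ε γ
    q-model-low = mentioned q {λ x → x ε β → x ε γ} (λ e f l → ε-respˡ e (f (ε-respˡ (≅-sym e) l))) q-low

    p-model-below : ∀ j {x} → x ε elt (A p) j → x ε β
    p-model-below = mentioned p {λ x → x ε β} ε-respˡ p-below

    Comparable : V → V → Set
    Comparable M N = ∃[ β ∈ ω₂ ]
      ( IsComparisonPoint M N β
      × (M ∩ β ≈ N ∩ β ⊎ M ∩ β ∈ Sk N ⊎ N ∩ β ∈ Sk M))

    opaque
      comparable : ∀ M N β → β ε ω₂ → Compared M N β → Comparable M N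
      comparable M N β (mem b e) c =
        let (β∈ , max) = Largest-to M N (Compared.point c)
        in b , (ε→∈ {y = Γ⟨ M ⟩ ∩ Γ⟨ N ⟩} (ε-respˡ e (∈→ε β∈)) ,
              λ i → ⊑→⊆ {elt (Γ⟨ M ⟩ ∩ Γ⟨ N ⟩) i} λ z →
                ≅→⊑ e (⊆→⊑ {elt (Γ⟨ M ⟩ ∩ Γ⟨ N ⟩) i} (max i) z)) , cases (Compared.cases c)
        where
        cases : M ∩ β ≅ N ∩ β ⊎ M ∩ β ε Sk N ⊎ N ∩ β ε Sk M →
          M ∩ elt ω₂ b ≈ N ∩ elt ω₂ b ⊎ M ∩ elt ω₂ b ∈ Sk N ⊎ N ∩ elt ω₂ b ∈ Sk M
        cases (inj₁ f)        = inj₁ (un (≅-trans (∩-congʳ M (≅-sym e)) (≅-trans f (∩-congʳ N e))))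
        cases (inj₂ (inj₁ f)) = inj₂ (inj₁ (ε→∈ (ε-respˡ (∩-congʳ M e) f)))
        cases (inj₂ (inj₂ f)) = inj₂ (inj₂ (ε→∈ (ε-respˡ (∩-congʳ N e) f)))

      compared : ∀ M N → (c : Comparable M N) → Compared M N (elt ω₂ (proj₁ c))
      compared M N (b , point , cases) = record { point = Largest-from M N point ; cases = convert cases }
        where
        convert : M ∩ elt ω₂ b ≈ N ∩ elt ω₂ b ⊎ M ∩ elt ω₂ b ∈ Sk N ⊎ N ∩ elt ω₂ b ∈ Sk M →
          M ∩ elt ω₂ b ≅ N ∩ elt ω₂ b ⊎ M ∩ elt ω₂ b ε Sk N ⊎ N ∩ elt ω₂ b ε Sk M
        convert (inj₁ e)        = inj₁ (eq e)
        convert (inj₂ (inj₁ f)) = inj₂ (inj₁ (∈→ε f))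
        convert (inj₂ (inj₂ f)) = inj₂ (inj₂ (∈→ε f))

      cross : ∀ j k → ∃ λ (ζ : El Γ) → Compared (elt (A p) j) (elt (A q) k) (val ζ)
      cross j k =
        let (j′ , agree) = models k
            M-model = model-in p (elt-ε {A p} j)
        in compare-through {M′ = elt (A p) j′} M-model (model-in q (elt-ε {A q} k)) (model-in p (elt-ε {A p} j′))
             α∈Γ β∈Γ γ<α α<β (thin (Model.∈𝒴 M-model)) (p-model-below j) (p-model-low j) (p-model-low j′)
             (q-model-low k) agree (compared (elt (A p) j) (elt (A p) j′) (proj₂ (A-adequate p) j j′))

      union-adequate : Adequate (A p ∪ A q)
      union-adequate =
        (λ { (inj₁ j) → proj₁ (A-adequate p) j ; (inj₂ k) → proj₁ (A-adequate q) k }) ,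
        λ { (inj₁ j) (inj₁ j′) → proj₂ (A-adequate p) j j′
          ; (inj₂ k) (inj₂ k′) → proj₂ (A-adequate q) k k′
          ; (inj₁ j) (inj₂ k)  → let (ζ , c) = cross j k in comparable _ _ (val ζ) (Γ⊑ω₂ (val-ε ζ)) c
          ; (inj₂ k) (inj₁ j)  → let (ζ , c) = cross j k in comparable _ _ (val ζ) (Γ⊑ω₂ (val-ε ζ)) (Compared-sym c)
          }

    labels : Condition → V
    labels r = set (Idx (Max r)) (label r)

    -- Collected into one set, so that a label common to p and q receives a single new node.
    Lab : V
    Lab = labels p ∪ labels q

    opaque
      shared-p : ∀ i {x} → label p i ≅ x → x ε γ → ∃ λ j → max p i ≅ max q j × x ≅ label q j
      shared-p i e x<γ = let (j , f , g) = graph-to i (ε-respˡ (≅-sym e) x<γ) in j , eq f , ≅-trans (≅-sym e) (eq g)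

      shared-q : ∀ j {x} → label q j ≅ x → x ε γ → ∃ λ i → max q j ≅ max p i × x ≅ label p i
      shared-q j e x<γ = let (i , f , g) = graph-from j (ε-respˡ (≅-sym e) x<γ) in i , eq f , ≅-trans (≅-sym e) (eq g)

      q-label-low : ∀ j {x} → label q j ≅ x → x ε β → x ε γ
      q-label-low j e x<β = ε-respˡ e (proj₂ q-low j (ε-respˡ (≅-sym e) x<β))

      p-label-below : ∀ i {x} → label p i ≅ x → x ε β
      p-label-below i e = ε-respˡ e (proj₂ p-below i)

    stem′ : Idx Lab → V
    stem′ = [ max p , max q ]

    stem : El Lab → V
    stem l = stem′ (index l)

    opaque
      -- `stem′` is defined by cases on the index. A label of q that is also one of p is below β,
      -- hence below γ, where p and q put it at the same node.
      stem′-p : ∀ s i → elt Lab s ≅ label p i → stem′ s ≅ max p i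
      stem′-p (inj₁ i′) i e = label-injective p {i′} {i} e
      stem′-p (inj₂ j)  i e =
        let (i′ , f , g) = shared-q j e (q-label-low j e (p-label-below i ≅-refl))
        in ≅-trans f (label-injective p {i′} {i} (≅-sym g))

      stem′-q : ∀ s j → elt Lab s ≅ label q j → stem′ s ≅ max q j
      stem′-q (inj₂ j′) j e = label-injective q {j′} {j} e
      stem′-q (inj₁ i)  j e =
        let (j′ , f , g) = shared-p i e (q-label-low j ≅-refl (p-label-below i e))
        in ≅-trans f (label-injective q {j′} {j} (≅-sym g))

      stem′-node : ∀ s → stem′ s ε nodes p
      stem′-node (inj₁ i) = elt-ε {nodes p} (proj₁ i)
      stem′-node (inj₂ j) = ≅→⊑ (≅-sym nodes≅) (elt-ε {nodes q} (proj₁ j))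

    stem-p : ∀ l i → val l ≅ label p i → stem l ≅ max p i
    stem-p l i e = stem′-p (index l) i (≅-trans (≅-sym (val-index l)) e)

    stem-q : ∀ l j → val l ≅ label q j → stem l ≅ max q j
    stem-q l j e = stem′-q (index l) j (≅-trans (≅-sym (val-index l)) e)

    p-label : Idx (Max p) → El Lab
    p-label i = toEl (elt-ε {Lab} (inj₁ i))

    val-p-label : ∀ i → val (p-label i) ≅ label p i
    val-p-label i = val-toEl (elt-ε {Lab} (inj₁ i))

    q-label : Idx (Max q) → El Lab
    q-label j = toEl (elt-ε {Lab} (inj₂ j))

    val-q-label : ∀ j → val (q-label j) ≅ label q j
    val-q-label j = val-toEl (elt-ε {Lab} (inj₂ j))

    opaque
      labels-finite : ∀ r → Finite (labels r)
      labels-finite r = let (n , f) = Max-finite r in n , record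
        { to        = Injection.to f
        ; cong      = λ {i} {j} e → Injection.cong f {i} {j} (un (label-injective r {i} {j} (eq e)))
        ; injective = λ {i} {j} e → un (label-cong r {i} {j} (eq (Injection.injective f {i} {j} e)))
        }

      Lab-finite : Finite Lab
      Lab-finite = ∪-finite (labels p) (labels q) (labels-finite p) (labels-finite q)

      start : ∃ λ (ξ : El ω₁) → ∀ (a : El (nodes p)) → val a ε val ξ
      start = ω₁.bounded (Finite→↣ℕ (finite p)) (λ (a : El (nodes p)) (ξ : El ω₁) → val a ε val ξ) (λ s → s)
        (λ a → let a∈ω₁ = ⊆→⊑ (nodes⊆ω₁ p) (val-ε a)
                   (ξ , l) = ω₁.no-maximum (toEl a∈ω₁)
               in ξ , ε-respˡ (val-toEl a∈ω₁) l)

      -- Finite successors of an ordinal above all nodes: each is new and contains every old node,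
      -- as the tree order requires.
      new-index : El Lab → El ω₁
      new-index l = ω₁.nextⁿ (Injection.to (Finite→↣ℕ Lab-finite) l) (proj₁ start)

      new-index-injective : ∀ {l m} → new-index l ≡ new-index m → l ≡ m
      new-index-injective e = Injection.injective (Finite→↣ℕ Lab-finite) (ω₁.nextⁿ-injective _ e)

    new : El Lab → V
    new l = val (new-index l)

    opaque
      unfolding new-index

      new-above : ∀ l {a} → a ε nodes p → a ε new l
      new-above l a∈ = ω₁.nextⁿ-⊒ (Injection.to (Finite→↣ℕ Lab-finite) l) _ (ε-respˡ (val-toEl a∈) (proj₂ start (toEl a∈)))

    opaque
      new∉nodes : ∀ {a} l → a ≅ new l → ¬ (a ε nodes p)
      new∉nodes l e a∈ = ε-irrefl e (new-above l a∈)

      new-injective : ∀ {l m} → new l ≅ new m → l ≡ m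
      new-injective e = new-index-injective (val-injective e)

    infix 4 _<ᵖ_ _≤ᵖ_ _<ᵘ_

    _<ᵖ_ _≤ᵖ_ _<ᵘ_ : V → V → Set
    a <ᵖ b = _<_ p a b
    a ≤ᵖ b = a <ᵖ b ⊎ a ≅ b
    -- Above the maximal node stem l, there is a new maximal node with label l.
    a <ᵘ b = a <ᵖ b ⊎ ∃ λ l → b ≅ new l × a ≤ᵖ stem l

    opaque
      <ᵖ-nodes : ∀ {a b} → a <ᵖ b → a ε nodes p × b ε nodes p
      <ᵖ-nodes l = let (a , b) = <⇒nodes p l in ∈→ε a , ∈→ε b

      ≤ᵖ-node : ∀ {a} l → a ≤ᵖ stem l → a ε nodes p
      ≤ᵖ-node l (inj₁ a<b) = proj₁ (<ᵖ-nodes a<b)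
      ≤ᵖ-node l (inj₂ a≅b) = ε-respˡ (≅-sym a≅b) (stem′-node (index l))

      <ᵘ-nodeˡ : ∀ {a b} → a <ᵘ b → a ε nodes p
      <ᵘ-nodeˡ (inj₁ a<b)         = proj₁ (<ᵖ-nodes a<b)
      <ᵘ-nodeˡ (inj₂ (l , _ , a≤)) = ≤ᵖ-node l a≤

      <ᵘ-old : ∀ {a b} → b ε nodes p → a <ᵘ b → a <ᵖ b
      <ᵘ-old b∈ (inj₁ a<b)        = a<b
      <ᵘ-old b∈ (inj₂ (l , e , _)) = contradiction b∈ (new∉nodes l e)

      <ᵘ-new : ∀ {a b} l → b ≅ new l → a <ᵘ b → a ≤ᵖ stem l
      <ᵘ-new l e (inj₁ a<b) = contradiction (proj₂ (<ᵖ-nodes a<b)) (new∉nodes l e)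
      <ᵘ-new l e (inj₂ (m , f , a≤)) with new-injective (≅-trans (≅-sym e) f)
      ... | refl = a≤

      ≤ᵖ-respˡ : ∀ {a a′ b} → a ≅ a′ → a ≤ᵖ b → a′ ≤ᵖ b
      ≤ᵖ-respˡ e (inj₁ l) = inj₁ (<-resp (T p) e ≅-refl l)
      ≤ᵖ-respˡ e (inj₂ f) = inj₂ (≅-trans (≅-sym e) f)

      <ᵖ-≤ᵖ-trans : ∀ {a b c} → a <ᵖ b → b ≤ᵖ c → a <ᵖ c
      <ᵖ-≤ᵖ-trans a<b (inj₁ b<c) = <-trans p a<b b<c
      <ᵖ-≤ᵖ-trans a<b (inj₂ b≅c) = <-resp (T p) ≅-refl b≅c a<b

      ≤ᵖ-below : ∀ {a b c} → a ≤ᵖ c → b ≤ᵖ c → a ≈ b ⊎ a <ᵖ b ⊎ b <ᵖ a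
      ≤ᵖ-below (inj₁ a<c) (inj₁ b<c) = <-below p a<c b<c
      ≤ᵖ-below (inj₁ a<c) (inj₂ b≅c) = inj₂ (inj₁ (<-resp (T p) ≅-refl (≅-sym b≅c) a<c))
      ≤ᵖ-below (inj₂ a≅c) (inj₁ b<c) = inj₂ (inj₂ (<-resp (T p) ≅-refl (≅-sym a≅c) b<c))
      ≤ᵖ-below (inj₂ a≅c) (inj₂ b≅c) = inj₁ (un (≅-trans a≅c (≅-sym b≅c)))

    new-nodes : V
    new-nodes = set (El Lab) new

    opaque
      new-nodes-finite : Finite new-nodes
      new-nodes-finite = let (n , f) = Lab-finite in n , record
        { to        = λ l → Injection.to (↣-from f) l
        ; cong      = λ {l} {m} e → cong (Injection.to (↣-from f)) (new-injective {l} {m} (eq e))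
        ; injective = λ {l} {m} e → un (≅-reflexive (cong new (Injection.injective (↣-from f) {l} {m} e)))
        }

      <ᵘ-nodes : ∀ {a b} → a <ᵘ b → a ε nodes p ∪ new-nodes × b ε nodes p ∪ new-nodes
      <ᵘ-nodes {b = b} l = ∪⁺ˡ (nodes p) new-nodes (<ᵘ-nodeˡ l) , right l
        where
        right : ∀ {a} → a <ᵘ b → b ε nodes p ∪ new-nodes
        right (inj₁ l)          = ∪⁺ˡ (nodes p) new-nodes (proj₂ (<ᵖ-nodes l))
        right (inj₂ (l , e , _)) = ∪⁺ʳ (nodes p) new-nodes (mem l e)

      <ᵘ-respʳ : ∀ {a b b′} → b ≅ b′ → a <ᵘ b → a <ᵘ b′
      <ᵘ-respʳ e (inj₁ l)           = inj₁ (<-resp (T p) ≅-refl e l)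
      <ᵘ-respʳ e (inj₂ (l , f , a≤)) = inj₂ (l , ≅-trans (≅-sym e) f , a≤)

      <ᵘ-respˡ : ∀ {a a′ b} → a ≅ a′ → a <ᵘ b → a′ <ᵘ b
      <ᵘ-respˡ e (inj₁ l)           = inj₁ (<-resp (T p) e ≅-refl l)
      <ᵘ-respˡ e (inj₂ (l , f , a≤)) = inj₂ (l , f , ≤ᵖ-respˡ e a≤)

      <ᵘ-irrefl : ∀ {a} → ¬ (a <ᵘ a)
      <ᵘ-irrefl l = <-irrefl p (<ᵘ-old (<ᵘ-nodeˡ l) l)

      <ᵘ-trans : ∀ {a b c} → a <ᵘ b → b <ᵘ c → a <ᵘ c
      <ᵘ-trans a<b b<c with <ᵘ-old (<ᵘ-nodeˡ b<c) a<b | b<c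
      ... | a<ᵖb | inj₁ b<ᵖc          = inj₁ (<-trans p a<ᵖb b<ᵖc)
      ... | a<ᵖb | inj₂ (l , e , b≤) = inj₂ (l , e , inj₁ (<ᵖ-≤ᵖ-trans a<ᵖb b≤))

      <ᵘ-below : ∀ {a b c} → a <ᵘ c → b <ᵘ c → a ≈ b ⊎ a <ᵘ b ⊎ b <ᵘ a
      <ᵘ-below {a} {b} (inj₁ a<c) b<c = lift-cases (<-below p a<c (<ᵘ-old (proj₂ (<ᵖ-nodes a<c)) b<c))
        where
        lift-cases : a ≈ b ⊎ a <ᵖ b ⊎ b <ᵖ a → a ≈ b ⊎ a <ᵘ b ⊎ b <ᵘ a
        lift-cases = [ inj₁ , [ inj₂ ∘ inj₁ ∘ inj₁ , inj₂ ∘ inj₂ ∘ inj₁ ] ]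
      <ᵘ-below {a} {b} (inj₂ (l , e , a≤)) b<c = lift-cases (≤ᵖ-below a≤ (<ᵘ-new l e b<c))
        where
        lift-cases : a ≈ b ⊎ a <ᵖ b ⊎ b <ᵖ a → a ≈ b ⊎ a <ᵘ b ⊎ b <ᵘ a
        lift-cases = [ inj₁ , [ inj₂ ∘ inj₁ ∘ inj₁ , inj₂ ∘ inj₂ ∘ inj₁ ] ]

      <ᵘ⇒ε : ∀ {a b} → a <ᵘ b → a ε b
      <ᵘ⇒ε (inj₁ l)           = ∈→ε (<⇒∈ p l)
      <ᵘ⇒ε (inj₂ (l , e , a≤)) = ≅→⊑ (≅-sym e) (new-above l (≤ᵖ-node l a≤))

      all-nodes⊆ω₁ : nodes p ∪ new-nodes ⊆ ω₁
      all-nodes⊆ω₁ (inj₁ i) = nodes⊆ω₁ p i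
      all-nodes⊆ω₁ (inj₂ l) = ε→∈ (val-ε (new-index l))

    U : FiniteTree ω₁
    U = record
      { nodes    = nodes p ∪ new-nodes
      ; nodes⊆ω₁ = all-nodes⊆ω₁
      ; finite   = ∪-finite (nodes p) new-nodes (finite p) new-nodes-finite
      ; _<_      = _<ᵘ_
      ; <-resp-≈ = (λ e → <ᵘ-respʳ (eq e)) , (λ e → <ᵘ-respˡ (eq e))
      ; <⇒nodes  = λ l → let (a , b) = <ᵘ-nodes l in ε→∈ a , ε→∈ b
      ; <-irrefl = <ᵘ-irrefl
      ; <-trans  = <ᵘ-trans
      ; <-below  = <ᵘ-below
      ; <⇒∈      = λ l → ε→∈ (<ᵘ⇒ε l)
      }

    MaxU : V
    MaxU = FiniteTree.Max U

    opaque
      -- An old node is below another old one or maximal in p. In the latter case it is the stem of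
      -- the label that p gives it.
      old-not-maximal : ∀ n → ¬ (∀ s → ¬ (elt (nodes p) n <ᵘ elt (nodes p ∪ new-nodes) s))
      old-not-maximal n maximal with decide (∃ λ m → elt (nodes p) n <ᵖ elt (nodes p) m)
      ... | yes (m , l) = maximal (inj₁ m) (inj₁ l)
      ... | no ∄        = maximal (inj₂ (p-label i))
        (inj₂ (p-label i , ≅-refl , inj₂ (≅-sym (stem-p (p-label i) i (val-p-label i)))))
        where
        i : Idx (Max p)
        i = n , λ m l → ∄ (m , l)

      new-maximal : ∀ l s → ¬ (new l <ᵘ elt (nodes p ∪ new-nodes) s)
      new-maximal l s lt = new∉nodes l ≅-refl (<ᵘ-nodeˡ lt)

    lab : Idx MaxU → El Lab
    lab (inj₂ l , _)       = l
    lab (inj₁ n , maximal) = contradiction maximal (old-not-maximal n)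

    new-lab : ∀ m → elt MaxU m ≅ new (lab m)
    new-lab (inj₂ l , _)       = ≅-refl
    new-lab (inj₁ n , maximal) = contradiction maximal (old-not-maximal n)

    label-index : Idx Lab → Idx ω₂
    label-index = [ Injection.to (F p) , Injection.to (F q) ]

    opaque
      elt-label-index : ∀ s → elt ω₂ (label-index s) ≅ elt Lab s
      elt-label-index (inj₁ i) = ≅-refl
      elt-label-index (inj₂ j) = ≅-refl

      elt-label : ∀ (l : El Lab) → elt ω₂ (label-index (index l)) ≅ val l
      elt-label l = ≅-trans (elt-label-index (index l)) (≅-sym (val-index l))

    G : Injection ⟦ MaxU ⟧ ⟦ ω₂ ⟧
    G = record
      { to        = λ m → label-index (index (lab m))
      ; cong      = λ {m} {n} e → un (≅-reflexive (cong (λ l → elt ω₂ (label-index (index l)))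
          (new-injective (≅-trans (≅-sym (new-lab m)) (≅-trans (eq {elt MaxU m} {elt MaxU n} e) (new-lab n))))))
      ; injective = λ {m} {n} e → un (≅-trans (new-lab m) (≅-trans (≅-reflexive (cong new
          (val-injective (≅-trans (≅-sym (elt-label (lab m))) (≅-trans (eq e) (elt-label (lab n))))))) (≅-sym (new-lab n))))
      }

    opaque
      -- A node below two new ones may be a stem, whereas clause (4) for r speaks of strict
      -- predecessors. The boundary cases contradict maximality or distinctness.
      separated-≤ : ∀ r j i i′ → ¬ (max r i ≅ max r i′) → label r i ε elt (A r) j → label r i′ ε elt (A r) j →
        ∀ {c} → _<_ r c (max r i) ⊎ c ≅ max r i → _<_ r c (max r i′) ⊎ c ≅ max r i′ → c ε elt (A r) j
      separated-≤ r j i i′ i≉i′ i∈M i′∈M (inj₁ l) (inj₁ l′) =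
        ∈→ε (separated r j i i′ (λ e → i≉i′ (eq e)) (ε→∈ i∈M) (ε→∈ i′∈M) _ l l′)
      separated-≤ r j i i′ i≉i′ i∈M i′∈M (inj₁ l) (inj₂ e) =
        contradiction (<-resp (T r) e ≅-refl l) (proj₂ i′ (proj₁ i))
      separated-≤ r j i i′ i≉i′ i∈M i′∈M (inj₂ e) (inj₁ l) =
        contradiction (<-resp (T r) e ≅-refl l) (proj₂ i (proj₁ i′))
      separated-≤ r j i i′ i≉i′ i∈M i′∈M (inj₂ e) (inj₂ f) = contradiction (≅-trans (≅-sym e) f) i≉i′

      -- Models of p lie below β, so a label of q in one of them is below β, hence below γ and
      -- shared with p.
      p-owns : ∀ j s {x} → elt Lab s ≅ x → x ε elt (A p) j → ∃ λ i → x ≅ label p i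
      p-owns j (inj₁ i) e x∈M = i , ≅-sym e
      p-owns j (inj₂ k) e x∈M =
        let (i , _ , f) = shared-q k e (q-label-low k e (p-model-below j x∈M)) in i , f

      -- Labels of p lie below β, and a model of q has no elements in [γ, β). A label of p in such a
      -- model is therefore below γ and shared with q.
      q-owns : ∀ k s {x} → elt Lab s ≅ x → x ε elt (A q) k → ∃ λ j → x ≅ label q j
      q-owns k (inj₂ j) e x∈N = j , ≅-sym e
      q-owns k (inj₁ i) e x∈N =
        let (j , _ , f) = shared-p i e (q-model-low k x∈N (p-label-below i e)) in j , f

      separated-p : ∀ j l m → ¬ (l ≡ m) → val l ε elt (A p) j → val m ε elt (A p) j →
        ∀ {c} → c ≤ᵖ stem l → c ≤ᵖ stem m → c ε elt (A p) j
      separated-p j l m l≢m l∈M m∈M c≤l c≤m =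
        let (i , e) = p-owns j (index l) (≅-sym (val-index l)) l∈M
            (i′ , f) = p-owns j (index m) (≅-sym (val-index m)) m∈M
        in separated-≤ p j i i′
             (λ d → l≢m (val-injective (≅-trans e (≅-trans (label-cong p {i} {i′} d) (≅-sym f)))))
             (ε-respˡ e l∈M) (ε-respˡ f m∈M) (move (stem-p l i e) c≤l) (move (stem-p m i′ f) c≤m)
        where
        move : ∀ {c x y} → x ≅ y → c ≤ᵖ x → c ≤ᵖ y
        move e (inj₁ l) = inj₁ (<-resp (T p) ≅-refl e l)
        move e (inj₂ f) = inj₂ (≅-trans f e)

      separated-q : ∀ k l m → ¬ (l ≡ m) → val l ε elt (A q) k → val m ε elt (A q) k →
        ∀ {c} → c ≤ᵖ stem l → c ≤ᵖ stem m → c ε elt (A q) k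
      separated-q k l m l≢m l∈N m∈N c≤l c≤m =
        let (j , e) = q-owns k (index l) (≅-sym (val-index l)) l∈N
            (j′ , f) = q-owns k (index m) (≅-sym (val-index m)) m∈N
        in separated-≤ q k j j′
             (λ d → l≢m (val-injective (≅-trans e (≅-trans (label-cong q {j} {j′} d) (≅-sym f)))))
             (ε-respˡ e l∈N) (ε-respˡ f m∈N) (move (stem-q l j e) c≤l) (move (stem-q m j′ f) c≤m)
        where
        move : ∀ {c x y} → x ≅ y → c ≤ᵖ x → _<_ q c y ⊎ c ≅ y
        move e (inj₁ l) = inj₁ (<-resp (T q) ≅-refl e (<-to l))
        move e (inj₂ f) = inj₂ (≅-trans f e)

    amalgam : Condition
    amalgam = record
      { T          = U
      ; F          = G
      ; A          = A p ∪ A q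
      ; A-finite   = ∪-finite (A p) (A q) (A-finite p) (A-finite q)
      ; A-adequate = union-adequate
      ; separated  = λ s m n m≉n m∈ n∈ c c<m c<n → ε→∈ (apart s m n (λ e → m≉n (un e)) (∈→ε m∈) (∈→ε n∈) c<m c<n)
      }
      where
      opaque
        apart : ∀ s m n → ¬ (elt MaxU m ≅ elt MaxU n) →
          elt ω₂ (label-index (index (lab m))) ε elt (A p ∪ A q) s →
          elt ω₂ (label-index (index (lab n))) ε elt (A p ∪ A q) s →
          ∀ {c} → c <ᵘ elt MaxU m → c <ᵘ elt MaxU n → c ε elt (A p ∪ A q) s
        apart s m n m≉n m∈ n∈ {c} c<m c<n = go s (ε-respˡ (elt-label (lab m)) m∈) (ε-respˡ (elt-label (lab n)) n∈)
          where
          distinct : ¬ (lab m ≡ lab n)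
          distinct e = m≉n (≅-trans (new-lab m) (≅-trans (≅-reflexive (cong new e)) (≅-sym (new-lab n))))
          go : ∀ s → val (lab m) ε elt (A p ∪ A q) s → val (lab n) ε elt (A p ∪ A q) s → c ε elt (A p ∪ A q) s
          go (inj₁ j) a b = separated-p j (lab m) (lab n) distinct a b (<ᵘ-new _ (new-lab m) c<m) (<ᵘ-new _ (new-lab n) c<n)
          go (inj₂ k) a b = separated-q k (lab m) (lab n) distinct a b (<ᵘ-new _ (new-lab m) c<m) (<ᵘ-new _ (new-lab n) c<n)

    opaque
      amalgam-≤p : amalgam ≤ℙ p
      amalgam-≤p =
        ( (λ i → inj₁ i , ≈-refl {elt (nodes p) i})
        , (λ a b → mk⇔ (<ᵘ-old (elt-ε {nodes p} b)) inj₁)) ,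
        (λ j → inj₁ j , ≈-refl {elt (A p) j}) ,
        λ i → let l = p-label i in
          (inj₂ l , new-maximal l) ,
          inj₁ (inj₂ (l , ≅-refl , inj₂ (≅-sym (stem-p l i (val-p-label i))))) ,
          un (≅-sym (≅-trans (elt-label l) (val-p-label i)))

      amalgam-≤q : amalgam ≤ℙ q
      amalgam-≤q =
        ( (λ i → ε→∈ (∪⁺ˡ (nodes p) new-nodes (≅→⊑ (≅-sym nodes≅) (elt-ε {nodes q} i))))
        , (λ a b → mk⇔ (λ l → <-to (<ᵘ-old (≅→⊑ (≅-sym nodes≅) (elt-ε {nodes q} b)) l)) (λ l → inj₁ (<-from l)))) ,
        (λ k → inj₂ k , ≈-refl {elt (A q) k}) ,
        λ j → let l = q-label j in
          (inj₂ l , new-maximal l) ,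
          inj₁ (inj₂ (l , ≅-refl , inj₂ (≅-sym (stem-q l j (val-q-label j))))) ,
          un (≅-sym (≅-trans (elt-label l) (val-q-label j)))

-- Reflection of types, and the chain condition

module Chains (em : ExcludedMiddle (lsuc 0ℓ)) (ext : Extensionality (lsuc 0ℓ) (lsuc 0ℓ))
  (S : Setting) (Γ : V) (Γ⊆Λ : Γ ⊆ Hull.Λ S) (Γ-stationary : IsStationary (Setting.ω₂ S) Γ) where
  open Classical em ext
  open El
  open Setting S
  open Cardinals S
  open Hull S
  open Hulls em ext S
  open Models em ext S
  open Codes em ext S Γ
  open Forcing S Γ

  Γ⊑ω₂ : Γ ⊑ ω₂
  Γ⊑ω₂ p = let mem (b , _) e = ⊆→⊑ {y = Λ} Γ⊆Λ p in mem b e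

  open Amalgamation em ext S Γ Γ⊑ω₂

  module _ (p : El ω₂ → Condition) where

    private
      -- At a point α closed under `R₁`, the π-index of M ∩ ζ is below α for all M in 𝒴 and ζ < α.
      -- Closure under `R₂` is the reflection of types.
      R₁ R₂ : El ω₂ → El ω₂ → Set
      R₁ γ ξ = ∀ (t : El (traces γ)) η → π⟨ η ⟩ ≅ val t → val η ε val ξ

      -- Membership in Γ and closure under `R₁` are included so that reflection returns an α with
      -- these properties too.
      HasType : El ω₂ → El ω₁ → El ω₂ → Set
      HasType γ w α = (val α ε Γ × Closed R₁ (val α)) × val γ ε val α ×
        Mentioned (p α) (λ x → x ε val α → x ε val γ) × code γ (p α) ≡ w

      Reflects : El ω₂ → El ω₁ → El ω₂ → Set
      Reflects γ w ξ = ∃ (HasType γ w) → ∃ λ α → HasType γ w α × val α ε val ξ × Mentioned (p α) (λ x → x ε val ξ)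

      R₂ γ ξ = ∀ w → Reflects γ w ξ

      Reflects-mono : ∀ {γ w ξ η} → val ξ ⊑ val η → Reflects γ w ξ → Reflects γ w η
      Reflects-mono s r t = let (α , t′ , α<ξ , (m , l)) = r t in α , t′ , s α<ξ , (λ j k → s (m j k)) , λ i → s (l i)

      opaque
        R₁-total : ∀ γ → ∃ (R₁ γ)
        R₁-total γ = ω₂.bounded (traces-small γ) (λ (t : El (traces γ)) ξ → ∀ η → π⟨ η ⟩ ≅ val t → val η ε val ξ)
          (λ s r η e → s (r η e)) bound
          where
          bound : ∀ (t : El (traces γ)) → ∃ λ (ξ : El ω₂) → ∀ η → π⟨ η ⟩ ≅ val t → val η ε val ξ
          bound t with decide (∃ λ η → π⟨ η ⟩ ≅ val t)
          ... | yes (η , e) = ω₂.next η , λ η′ e′ →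
            ε-respˡ (≅-reflexive (cong val (π-injective (≅-trans e (≅-sym e′))))) (ω₂.<-next η)
          ... | no ∄        = ω₂.element , λ η e → contradiction (η , e) ∄

        -- There are at most ω₁ types w for γ. One example α for each realised type is enough, and
        -- the bound also exceeds all ordinals mentioned in p(α).
        R₂-total : ∀ γ → ∃ (R₂ γ)
        R₂-total γ = ω₂.bounded (mk↣ {to = id} id) (λ w ξ → Reflects γ w ξ)
          (λ {w} {ξ} {η} → Reflects-mono {γ} {w} {ξ} {η}) bound
          where
          bound : ∀ w → ∃ (Reflects γ w)
          bound w with decide (∃ (HasType γ w))
          ... | no ∄        = ω₂.element , λ t → contradiction t ∄
          ... | yes (α , t) =
            let (ξ , (m , l)) = mentioned-bound ω₂-bounds (p α) (λ x ξ → x ε val ξ) ε-respˡ (λ s → s)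
                  (λ x x∈ω₂ → ω₂.next (toEl x∈ω₂) , ε-respˡ (val-toEl x∈ω₂) (ω₂.<-next (toEl x∈ω₂)))
                (ζ , α<ζ , ξ<ζ) = ω₂.∃-upper α ξ
                ξ⊑ζ : val ξ ⊑ val ζ
                ξ⊑ζ q = Ord.transitive (ω₂.val-ord ζ) q ξ<ζ
            in ζ , λ _ → α , t , α<ζ , (λ j k → ξ⊑ζ (m j k)) , λ i → ξ⊑ζ (l i)

      R : El ω₂ → El ω₂ → Set
      R γ ξ = R₁ γ ξ × R₂ γ ξ

      opaque
        R-total : ∀ γ → ∃ (R γ)
        R-total γ =
          let (ξ , r₁) = R₁-total γ
              (η , r₂) = R₂-total γ
              (ζ , ξ<ζ , η<ζ) = ω₂.∃-upper ξ η
          in ζ , (λ t η e → Ord.transitive (ω₂.val-ord ζ) (r₁ t η e) ξ<ζ)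
               , λ w → Reflects-mono {γ} {w} {η} {ζ} (λ q → Ord.transitive (ω₂.val-ord ζ) q η<ζ) (r₂ w)

        low-bound : ∀ β → val β ε Γ → ∃ λ (γ : El ω₂) → val γ ε val β × Mentioned (p β) (λ x → x ε val β → x ε val γ)
        low-bound β β∈Γ =
          let (γ , (m , l)) = mentioned-bound (Λ-bounds β∈Λ) (p β) (λ x ξ → x ε val β → x ε val ξ)
                (λ e f x<β → ε-respˡ e (f (ε-respˡ (≅-sym e) x<β))) (λ s f x<β → s (f x<β)) (λ x _ → above x)
              γ≅ = ≅→⊑ (≅-sym (ω₂.val-below β γ))
          in ω₂.below β γ , ε-respˡ (≅-sym (ω₂.val-below β γ)) (val-ε γ) ,
             (λ j k x<β → γ≅ (m j k x<β)) , λ i x<β → γ≅ (l i x<β)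
          where
          β∈Λ : val β ε Λ
          β∈Λ = ⊆→⊑ {y = Λ} Γ⊆Λ β∈Γ
          above : ∀ x → ∃ λ (γ : El (val β)) → x ε val β → x ε val γ
          above x with decide (x ε val β)
          ... | yes x<β = let (γ , x<γ) = Λ-limit β∈Λ x<β in γ , λ _ → x<γ
          -- Any element of β will do, as nothing is required of an x outside β.
          ... | no x≮β  = Λ-element β∈Λ , λ x<β → contradiction x<β x≮β

        thin : ∀ {α : El ω₂} {M ζ} → Closed R₁ (val α) → M ε 𝒴 → ζ ε val α → ∀ η → π⟨ η ⟩ ≅ M ∩ ζ → val η ε val α
        thin {α} {M} {ζ} closed M∈𝒴 ζ<α η e =
          let ζ∈ω₂ = Ord.transitive ω₂-ord ζ<α (val-ε α)
              ζ≅ = val-toEl ζ∈ω₂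
              (ξ , ξ<α , r) = closed (toEl ζ∈ω₂) (ε-respˡ (≅-sym ζ≅) ζ<α)
              t∈ = trace-ε (toEl ζ∈ω₂) M∈𝒴
          in Ord.transitive (ω₂.val-ord α)
               (r (toEl t∈) η (≅-trans e (≅-trans (∩-congʳ M (≅-sym ζ≅)) (≅-sym (val-toEl t∈))))) ξ<α

    opaque
      compatible-pair : ∃ λ α → ∃ λ β → ¬ (α ≡ β) × Compatible ℙ _≤ℙ_ (p α) (p β)
      compatible-pair =
        let (β , β∈Γ , closed) = stationary-closed R R-total Γ-stationary
            (γ , γ<β , low) = low-bound β β∈Γ
            (ξ , ξ<β , _ , reflects) = closed γ γ<β
            R₁-closed : Closed R₁ (val β)
            R₁-closed δ δ<β = let (ζ , ζ<β , r₁ , _) = closed δ δ<β in ζ , ζ<β , r₁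
            (α , ((α∈Γ , α-closed) , γ<α , low′ , e) , α<ξ , below) =
              -- β is itself an example of the type of p(β), so reflection provides another one
              -- whose ordinals are all below ξ < β.
              reflects (code γ (p β)) (β , (β∈Γ , R₁-closed) , γ<β , low , refl)
        in α , β , amalgamate α β γ ξ β∈Γ ξ<β low α∈Γ α-closed γ<α low′ e α<ξ below
        where
        amalgamate : ∀ (α β γ ξ : El ω₂) → val β ε Γ → val ξ ε val β → Mentioned (p β) (λ x → x ε val β → x ε val γ) →
          val α ε Γ → Closed R₁ (val α) → val γ ε val α → Mentioned (p α) (λ x → x ε val α → x ε val γ) →
          code γ (p α) ≡ code γ (p β) → val α ε val ξ → Mentioned (p α) (λ x → x ε val ξ) →
          ¬ (α ≡ β) × Compatible ℙ _≤ℙ_ (p α) (p β)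
        amalgamate α β γ ξ β∈Γ ξ<β low α∈Γ α-closed γ<α low′ e α<ξ (m , l) =
          (λ α≡β → ε-irrefl (≅-reflexive (cong val α≡β)) α<β) , M.amalgam , M.amalgam-≤p , M.amalgam-≤q
          where
          α<β : val α ε val β
          α<β = Ord.transitive (ω₂.val-ord β) α<ξ ξ<β
          below : Mentioned (p α) (λ x → x ε val β)
          below = (λ j k → Ord.transitive (ω₂.val-ord β) (m j k) ξ<β) ,
                  λ i → Ord.transitive (ω₂.val-ord β) (l i) ξ<β
          module M = Amalgam (p α) (p β) α∈Γ β∈Γ γ<α α<β (thin {α} α-closed) low′ low below
            (code-same γ (p α) (p β) e)

  -- Unless the antichain injects into ω₁, comparability of cardinals selects ω₂ inequivalent
  -- members, two of which would be compatible.
  chain-condition : ChainCondition ℙ _≤ℙ_ ω₂ (lsuc 0ℓ)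
  chain-condition A antichain with em {On.setoid {B = Σ Condition A} ℙ proj₁ ≼ setoid (El ω₁)}
  ... | yes f = ≺ω₂-intro f
  ... | no A⋠ω₁ =
    let (f , injective) = ω₂-embed em (lower-extensionality (lsuc 0ℓ) (lsuc 0ℓ) ext) (On.setoid {B = Σ Condition A} ℙ proj₁) A⋠ω₁
        (α , β , α≢β , compatible) = compatible-pair (λ ξ → proj₁ (f ξ))
    in contradiction compatible (antichain (proj₂ (f α)) (proj₂ (f β)) (λ e → α≢β (injective e)))

proposition7p10 : ExcludedMiddle (lsuc 0ℓ) → Extensionality (lsuc 0ℓ) (lsuc 0ℓ) →
    (S : Setting) (Γ : V) → Γ ⊆ Hull.Λ S → IsStationary (Setting.ω₂ S) Γ →
    ChainCondition (Forcing.ℙ S Γ) (Forcing._≤ℙ_ S Γ) (Setting.ω₂ S) (lsuc 0ℓ)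
proposition7p10 em ext S Γ Γ⊆Λ stationary = Chains.chain-condition em ext S Γ Γ⊆Λ stationary
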